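{- Let $w\ge0$ be an integer. If $w$ is even, the map $\mathrm{LSh}^{(2)}_w\to W_w$, $P\mapsto P|\delta$, is well defined and bijective. If $w$ is odd, the map $\mathrm{LSh}^{(2)}_w\to\mathrm{Hom}_{\mathbb Q}(W_w,\mathbb Q)$ sending $P$ to the functional $Q\mapsto(P,Q)$ is an isomorphism of $\mathbb Q$-vector spaces. In both cases $\dim_{\mathbb Q}\mathrm{LSh}^{(2)}_w=\lfloor\frac{w+2}{3}\rfloor$.
   Context: $V_w$ is the $\mathbb Q$-space of homogeneous polynomials of degree $w$ in $X,Y$. $\mathrm{GL}_2(\mathbb Z)$ acts on the right by $(P|A)(X,Y)=P(aX+bY,cX+dY)$ for $A=\begin{pmatrix}a&b\\c&d\end{pmatrix}$, extended linearly to $\mathbb Q[\mathrm{GL}_2(\mathbb Z)]$. $\varepsilon=\begin{pmatrix}0&1\\1&0\end{pmatrix}$, $\gamma=\begin{pmatrix}0&-1\\1&-1\end{pmatrix}$, $\delta=\begin{pmatrix}1&0\\0&-1\end{pmatrix}$, $\varepsilon'=\delta\varepsilon\delta$, $\gamma'=\delta\gamma\delta$. $\mathrm{LSh}^{(2)}_w=\{P\in V_w: P(X,X+Y)+P(Y,X+Y)=-P(X,-Y),\ P(X,Y)=P(-Y,-X)\}$. $W_w=\{Q\in V_w: Q|(1-\varepsilon')=0,\ Q|(1+\gamma'+\gamma'^2)=0\}$. Pairing: $\langle X^aY^{w-a},X^bY^{w-b}\rangle=(-1)^{a+1}\binom{w}{b}^{ -1}\delta_{a,w-b}$ ($0\le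 a,b\le w$, Kronecker delta), extended bilinearly to $V_w\times V_w$, and $(P,Q):=\langle P|\delta,Q\rangle$. -}

module Defs where

open import Data.Nat as ℕ using (ℕ; zero; suc; _∸_; _≤ᵇ_)
open import Data.Nat.Combinatorics using (_C_)
open import Data.Integer as ℤ using (ℤ; +_)
open import Data.Rational using (ℚ; _+_; _*_; -_; 0ℚ; 1ℚ; _/_)
import Data.Fin
open Data.Fin using (Fin; toℕ)
open import Data.Bool using (if_then_else_)
open import Data.Product using (Σ; _×_; ∃)
open import Relation.Binary.PropositionalEquality using (_≡_)

sumTo : ℕ → (ℕ → ℚ) → ℚ
sumTo zero    f = f 0
sumTo (suc n) f = sumTo n f + f (suc n)

sumFin : (n : ℕ) → (Fin n → ℚ) → ℚ
sumFin zero    f = 0ℚ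
sumFin (suc n) f = f Data.Fin.zero + sumFin n (λ i → f (Data.Fin.suc i))

ℤ→ℚ : ℤ → ℚ
ℤ→ℚ z = z / 1

ℕ→ℚ : ℕ → ℚ
ℕ→ℚ n = (+ n) / 1

-- inverse of a natural number (only used on nonzero binomial coefficients)
invℕ : ℕ → ℚ
invℕ zero    = 0ℚ
invℕ (suc n) = (+ 1) / suc n

-- V_w : homogeneous polynomials of degree w in X,Y over ℚ.
-- P i is the coefficient of X^i Y^(w-i),  i = 0..w.

V : ℕ → Set
V w = Fin (suc w) → ℚ

infix 4 _≈_
_≈_ : {w : ℕ} → V w → V w → Set
P ≈ Q = ∀ i → P i ≡ Q i

zeroV : {w : ℕ} → V w
zeroV _ = 0ℚ

_⊕_ : {w : ℕ} → V w → V w → V w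
(P ⊕ Q) i = P i + Q i

_⊛_ : {w : ℕ} → ℚ → V w → V w
(c ⊛ P) i = c * P i

-- 2x2 integer matrices and the right action  (P|A)(X,Y) = P(aX+bY, cX+dY)

record Mat : Set where
  constructor mat
  field a b c d : ℤ

infixl 7 _·_
_·_ : Mat → Mat → Mat
mat a b c d · mat a' b' c' d' =
  mat (a ℤ.* a' ℤ.+ b ℤ.* c') (a ℤ.* b' ℤ.+ b ℤ.* d')
      (c ℤ.* a' ℤ.+ d ℤ.* c') (c ℤ.* b' ℤ.+ d ℤ.* d')

-- coefficient of X^k Y^(w-k) in (aX+bY)^i (cX+dY)^(w-i)  (binomial expansion):
--   Σ_{j=0}^{i} [j ≤ k] C(i,j) a^j b^(i-j) C(w-i,k-j) c^(k-j) d^(w-i-(k-j))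
actCoef : Mat → (w i k : ℕ) → ℚ
actCoef (mat a b c d) w i k =
  sumTo i (λ j → if j ≤ᵇ k
    then ℕ→ℚ (i C j) * ℤ→ℚ (a ℤ.^ j) * ℤ→ℚ (b ℤ.^ (i ∸ j))
         * ℕ→ℚ ((w ∸ i) C (k ∸ j)) * ℤ→ℚ (c ℤ.^ (k ∸ j))
         * ℤ→ℚ (d ℤ.^ ((w ∸ i) ∸ (k ∸ j)))
    else 0ℚ)

_∣_ : {w : ℕ} → V w → Mat → V w
_∣_ {w} P A k = sumFin (suc w) (λ i → P i * actCoef A w (toℕ i) (toℕ k))

ε δ γ ε′ γ′ : Mat
ε  = mat (+ 0) (+ 1) (+ 1) (+ 0)
γ  = mat (+ 0) (ℤ.- (+ 1)) (+ 1) (ℤ.- (+ 1))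
δ  = mat (+ 1) (+ 0) (+ 0) (ℤ.- (+ 1))
ε′ = δ · ε · δ
γ′ = δ · γ · δ

-- P(X,X+Y), P(Y,X+Y), P(X,-Y)=P|δ, P(-Y,-X)
T₁ T₂ S : Mat
T₁ = mat (+ 1) (+ 0) (+ 1) (+ 1)
T₂ = mat (+ 0) (+ 1) (+ 1) (+ 1)
S  = mat (+ 0) (ℤ.- (+ 1)) (ℤ.- (+ 1)) (+ 0)

InLSh : (w : ℕ) → V w → Set
InLSh w P = ((P ∣ T₁) ⊕ (P ∣ T₂)) ≈ ((- 1ℚ) ⊛ (P ∣ δ)) × P ≈ (P ∣ S)

InW : (w : ℕ) → V w → Set
InW w Q = (Q ⊕ ((- 1ℚ) ⊛ (Q ∣ ε′))) ≈ zeroV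
        × ((Q ⊕ (Q ∣ γ′)) ⊕ (Q ∣ (γ′ · γ′))) ≈ zeroV

kron : ℕ → ℕ → ℚ
kron m n = if m ℕ.≡ᵇ n then 1ℚ else 0ℚ

⟨_,_⟩ : {w : ℕ} → V w → V w → ℚ
⟨_,_⟩ {w} P Q = sumFin (suc w) (λ a → sumFin (suc w) (λ b →
  P a * Q b * ℤ→ℚ ((ℤ.- (+ 1)) ℤ.^ suc (toℕ a)) * invℕ (w C toℕ b)
        * kron (toℕ a) (w ∸ toℕ b)))

pair : {w : ℕ} → V w → V w → ℚ
pair P Q = ⟨ P ∣ δ , Q ⟩

-- a functional is a function φ on elements of W_w (with membership proof),
-- independent of the proof and respecting ≈, additive and ℚ-homogeneous.
IsLinearW : (w : ℕ) → ((Q : V w) → InW w Q → ℚ) → Set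
IsLinearW w φ =
    (∀ (Q Q′ : V w) (p : InW w Q) (p′ : InW w Q′) → Q ≈ Q′ → φ Q p ≡ φ Q′ p′)
  × (∀ (Q Q′ : V w) (p : InW w Q) (p′ : InW w Q′) (p″ : InW w (Q ⊕ Q′)) →
       φ (Q ⊕ Q′) p″ ≡ φ Q p + φ Q′ p′)
  × (∀ (c : ℚ) (Q : V w) (p : InW w Q) (p′ : InW w (c ⊛ Q)) →
       φ (c ⊛ Q) p′ ≡ c * φ Q p)

FunctionalW : ℕ → Set
FunctionalW w = Σ ((Q : V w) → InW w Q → ℚ) (IsLinearW w)

lincomb : {w n : ℕ} → (Fin n → ℚ) → (Fin n → V w) → V w
lincomb {w} {n} c b k = sumFin n (λ i → c i * b i k)

HasDim : {w : ℕ} → (V w → Set) → ℕ → Set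
HasDim {w} U n = Σ (Fin n → V w) λ b →
    (∀ i → U (b i))
  × (∀ (c : Fin n → ℚ) → lincomb c b ≈ zeroV → ∀ i → c i ≡ 0ℚ)
  × (∀ P → U P → Σ (Fin n → ℚ) λ c → lincomb c b ≈ P)

{-# OPTIONS --safe #-}

-- A form P of degree w is handled through its values P(x , y) at rational points, which determine it.
--
-- In terms of G = P|δ the defining relations of LSh read G(x , y) = G(y , x) and
-- G(x , y) + G(y , z) + G(z , x) = 0 where z = - x - y, while those of W read G(x , y) = G(- y , - x)
-- and the same cyclic relation.  For even w these coincide.
--
-- For the duality, ⟨ R , (uX + vY)ʷ ⟩ = - R(- v , u).  The dihedral group of order 6 generated by ε′
-- and γ′ yields a projection π onto W in its group ring.  A functional φ on W extends to φ ∘ π, which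
-- is represented by some R; the invariance of π translates into the relations of G for R.
-- Conversely, if R satisfies them, then ⟨ R , π (uX + vY)ʷ ⟩ = - R(- v , u), so R is determined by
-- the functional ⟨ R , - ⟩ on W.
--
-- For the dimension, an element P of LSh with P(0 , 1) = 0 also vanishes at (1 , 0) and (1 , 1), hence
-- is XY(X - Y) times an element of LSh of degree w - 3, and Xʷ + (-Y)ʷ - 2(Y - X)ʷ lies in LSh
-- and does not vanish at (0 , 1) when w > 0.
module Submission where

open import Defs

-- The action is defined by sums of products of binomial coefficients, and composing matrices at
-- that level would be laborious. After evaluation `P ∣ A` is a linear substitution, so each
-- manipulation of the relations becomes a ring identity. The way back from values to coefficients
-- uses only the points (x , 1) with x > r; the bound r is left free so that the zeros of a divisor
-- can be avoided. The shape of the duality comes from reading (uX + vY)ʷ at the point (- v , u).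
-- Acting by ε′ replaces (u , v) by (- v , - u), hence exchanges the two coordinates of that point,
-- with no sign; acting by γ′ moves the point by the inverse of γ′. Symmetry under ε′ on the side of
-- W therefore becomes the plain exchange G(x , y) = G(y , x) on the other side, while the cyclic
-- relation keeps its form.

module Shuffle where

  open import Data.Nat as ℕ using (ℕ; zero; suc; _∸_; _≤ᵇ_; z≤n; s≤s)
  import Data.Nat.Properties as ℕₚ
  open import Data.Nat.Combinatorics using (_C_; k>n⇒nCk≡0; nCk+nC[k+1]≡[n+1]C[k+1])
  open import Data.Nat.DivMod using (_%_; m≡m%n+[m/n]*n; m/n≡1+[m∸n]/n)
  open import Data.Integer as ℤ using ()
  import Data.Integer.Properties as ℤₚ
  open import Data.Rational using (ℚ; _+_; _*_; -_; _-_; 0ℚ; 1ℚ; _<_; 1/_; ≢-nonZero)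
  open import Data.Rational.Properties
  open import Data.Rational.Unnormalised using (mkℚᵘ; *≡*)
  import Data.Rational.Unnormalised.Properties as ℚᵘₚ
  open import Data.Fin using (Fin; toℕ; opposite; inject₁; fromℕ) renaming (zero to fzero; suc to fsuc)
  open import Data.Fin.Properties using (toℕ≤pred[n]; opposite-prop; opposite-involutive)
  open import Data.Vec.Functional using (_∷_)
  open import Data.Bool using (true; false; if_then_else_; T)
  open import Data.Product using (Σ; _×_; _,_; proj₁; proj₂)
  open import Data.Sum using (_⊎_; inj₁; inj₂)
  open import Function using (_∘_)
  open import Relation.Nullary using (¬_; contradiction)
  open import Relation.Nullary.Decidable using (dec⇒maybe; toWitness)
  open import Relation.Binary.PropositionalEquality
  open import Algebra.Bundles using (CommutativeRing)
  open import Tactic.RingSolver using (solve-∀)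
  open import Tactic.RingSolver.Core.AlmostCommutativeRing using (AlmostCommutativeRing; fromCommutativeRing)

  open CommutativeRing +-*-commutativeRing using (commutativeSemiring; semiring; +-commutativeMonoid)
  open import Algebra.Properties.CommutativeSemiring.Exp commutativeSemiring using (_^_; ^-distrib-*; ^-homo-*; ^-assocʳ)
  open import Algebra.Properties.Semiring.Mult semiring using () renaming (_×_ to _×ₘ_)
  import Algebra.Properties.CommutativeSemiring.Binomial commutativeSemiring as Binomial
  import Algebra.Properties.CommutativeMonoid.Sum +-commutativeMonoid as Sum
  open ≡-Reasoning

  ring : AlmostCommutativeRing _ _
  ring = fromCommutativeRing +-*-commutativeRing (λ x → dec⇒maybe (0ℚ ≟ x))

  -- Finite sums and their reindexing

  sumFin-cong : ∀ n {f g : Fin n → ℚ} → (∀ i → f i ≡ g i) → sumFin n f ≡ sumFin n g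
  sumFin-cong zero    f≗g = refl
  sumFin-cong (suc n) f≗g = cong₂ _+_ (f≗g fzero) (sumFin-cong n (f≗g ∘ fsuc))

  sumFin-0 : ∀ n → sumFin n (λ _ → 0ℚ) ≡ 0ℚ
  sumFin-0 zero    = refl
  sumFin-0 (suc n) = trans (+-identityˡ _) (sumFin-0 n)

  interchange : ∀ a b c d → (a + b) + (c + d) ≡ (a + c) + (b + d)
  interchange = solve-∀ ring

  sumFin-+ : ∀ n (f g : Fin n → ℚ) → sumFin n (λ i → f i + g i) ≡ sumFin n f + sumFin n g
  sumFin-+ zero    f g = refl
  sumFin-+ (suc n) f g = trans
    (cong ((f fzero + g fzero) +_) (sumFin-+ n (f ∘ fsuc) (g ∘ fsuc)))
    (interchange (f fzero) (g fzero) (sumFin n (f ∘ fsuc)) (sumFin n (g ∘ fsuc)))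

  sumFin-*ˡ : ∀ n c (f : Fin n → ℚ) → sumFin n (λ i → c * f i) ≡ c * sumFin n f
  sumFin-*ˡ zero    c f = sym (*-zeroʳ c)
  sumFin-*ˡ (suc n) c f = trans
    (cong ((c * f fzero) +_) (sumFin-*ˡ n c (f ∘ fsuc))) (sym (*-distribˡ-+ c (f fzero) (sumFin n (f ∘ fsuc))))

  sumFin-*ʳ : ∀ n c (f : Fin n → ℚ) → sumFin n (λ i → f i * c) ≡ sumFin n f * c
  sumFin-*ʳ n c f = trans (sumFin-cong n (λ i → *-comm (f i) c)) (trans (sumFin-*ˡ n c f) (*-comm c _))

  sumFin-swap : ∀ m n (f : Fin m → Fin n → ℚ) →
    sumFin m (λ i → sumFin n (f i)) ≡ sumFin n (λ j → sumFin m (λ i → f i j))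
  sumFin-swap zero    n f = sym (sumFin-0 n)
  sumFin-swap (suc m) n f = trans
    (cong (sumFin n (f fzero) +_) (sumFin-swap m n (f ∘ fsuc)))
    (sym (sumFin-+ n (f fzero) (λ j → sumFin m (λ i → f (fsuc i) j))))

  sumFin-product : ∀ m n (f : Fin m → ℚ) (g : Fin n → ℚ) →
    sumFin m (λ i → sumFin n (λ j → f i * g j)) ≡ sumFin m f * sumFin n g
  sumFin-product m n f g =
    trans (sumFin-cong m (λ i → sumFin-*ˡ n (f i) g)) (sumFin-*ʳ m (sumFin n g) f)

  sumFin-truncate : ∀ m e (h : ℕ → ℚ) → (∀ l → m ℕ.≤ l → h l ≡ 0ℚ) →
    sumFin (m ℕ.+ e) (h ∘ toℕ) ≡ sumFin m (h ∘ toℕ)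
  sumFin-truncate zero    e h h≡0 = trans (sumFin-cong e (λ i → h≡0 (toℕ i) z≤n)) (sumFin-0 e)
  sumFin-truncate (suc m) e h h≡0 =
    cong (h 0 +_) (sumFin-truncate m e (h ∘ suc) (λ l m≤l → h≡0 (suc l) (s≤s m≤l)))

  suc≤ᵇsuc : ∀ j k → (suc j ≤ᵇ suc k) ≡ (j ≤ᵇ k)
  suc≤ᵇsuc zero    k = refl
  suc≤ᵇsuc (suc j) k = refl

  sumFin-shift : ∀ j n (h : ℕ → ℚ) →
    sumFin (j ℕ.+ n) (λ k → if j ≤ᵇ toℕ k then h (toℕ k ∸ j) else 0ℚ) ≡ sumFin n (h ∘ toℕ)
  sumFin-shift zero    n h = refl
  sumFin-shift (suc j) n h = trans (+-identityˡ _) (trans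
    (sumFin-cong (j ℕ.+ n) (λ k → cong (λ b → if b then h (toℕ k ∸ j) else 0ℚ) (suc≤ᵇsuc j (toℕ k))))
    (sumFin-shift j n h))

  sumTo-suc : ∀ n f → sumTo (suc n) f ≡ f 0 + sumTo n (f ∘ suc)
  sumTo-suc zero    f = refl
  sumTo-suc (suc n) f = trans (cong (_+ f (suc (suc n))) (sumTo-suc n f)) (+-assoc (f 0) _ _)

  sumTo≡sumFin : ∀ n f → sumTo n f ≡ sumFin (suc n) (f ∘ toℕ)
  sumTo≡sumFin zero    f = sym (+-identityʳ _)
  sumTo≡sumFin (suc n) f = trans (sumTo-suc n f) (cong (f 0 +_) (sumTo≡sumFin n (f ∘ suc)))

  -- Integers inside the rationals and the binomial theorem

  ℤ→ℚ-* : ∀ a b → ℤ→ℚ (a ℤ.* b) ≡ ℤ→ℚ a * ℤ→ℚ b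
  ℤ→ℚ-* a b = toℚᵘ-injective (ℚᵘₚ.≃-trans (toℚᵘ-fromℚᵘ (mkℚᵘ (a ℤ.* b) 0)) (ℚᵘₚ.≃-sym
    (ℚᵘₚ.≃-trans (toℚᵘ-homo-* (ℤ→ℚ a) (ℤ→ℚ b))
      (ℚᵘₚ.*-cong (toℚᵘ-fromℚᵘ (mkℚᵘ a 0)) (toℚᵘ-fromℚᵘ (mkℚᵘ b 0))))))

  ℤ→ℚ-+ : ∀ a b → ℤ→ℚ (a ℤ.+ b) ≡ ℤ→ℚ a + ℤ→ℚ b
  ℤ→ℚ-+ a b = toℚᵘ-injective (ℚᵘₚ.≃-trans (toℚᵘ-fromℚᵘ (mkℚᵘ (a ℤ.+ b) 0)) (ℚᵘₚ.≃-sym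
    (ℚᵘₚ.≃-trans (toℚᵘ-homo-+ (ℤ→ℚ a) (ℤ→ℚ b))
      (ℚᵘₚ.≃-trans (ℚᵘₚ.+-cong (toℚᵘ-fromℚᵘ (mkℚᵘ a 0)) (toℚᵘ-fromℚᵘ (mkℚᵘ b 0)))
        (*≡* (cong (ℤ._* ℤ.+ 1) (cong₂ ℤ._+_ (ℤₚ.*-identityʳ a) (ℤₚ.*-identityʳ b))))))))

  ℤ→ℚ-^ : ∀ a n → ℤ→ℚ (a ℤ.^ n) ≡ ℤ→ℚ a ^ n
  ℤ→ℚ-^ a zero    = refl
  ℤ→ℚ-^ a (suc n) = trans (ℤ→ℚ-* a (a ℤ.^ n)) (cong (ℤ→ℚ a *_) (ℤ→ℚ-^ a n))

  ×ₘ≡ℕ→ℚ* : ∀ n q → n ×ₘ q ≡ ℕ→ℚ n * q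
  ×ₘ≡ℕ→ℚ* zero    q = sym (*-zeroˡ q)
  ×ₘ≡ℕ→ℚ* (suc n) q = begin
    q + n ×ₘ q              ≡⟨ cong₂ _+_ (sym (*-identityˡ q)) (×ₘ≡ℕ→ℚ* n q) ⟩
    1ℚ * q + ℕ→ℚ n * q      ≡⟨ sym (*-distribʳ-+ q 1ℚ (ℕ→ℚ n)) ⟩
    (1ℚ + ℕ→ℚ n) * q        ≡⟨ cong (_* q) (sym (ℤ→ℚ-+ (ℤ.+ 1) (ℤ.+ n))) ⟩
    ℕ→ℚ (suc n) * q         ∎

  sum≡sumFin : ∀ n (f : Fin n → ℚ) → Sum.sum f ≡ sumFin n f
  sum≡sumFin zero    f = refl
  sum≡sumFin (suc n) f = cong (f fzero +_) (sum≡sumFin n (f ∘ fsuc))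

  binomial-expansion : ∀ n (a b x y : ℚ) → (a * x + b * y) ^ n ≡
    sumFin (suc n) (λ j → ℕ→ℚ (n C toℕ j) * a ^ toℕ j * b ^ (n ∸ toℕ j) * (x ^ toℕ j * y ^ (n ∸ toℕ j)))
  binomial-expansion n a b x y = trans (Binomial.theorem n (a * x) (b * y))
    (trans (sum≡sumFin (suc n) (Binomial.binomialTerm (a * x) (b * y) n)) (sumFin-cong (suc n) term))
    where
    shuffle : ∀ c p q r s → c * ((p * q) * (r * s)) ≡ c * p * r * (q * s)
    shuffle = solve-∀ ring
    term : ∀ j → Binomial.binomialTerm (a * x) (b * y) n j
      ≡ ℕ→ℚ (n C toℕ j) * a ^ toℕ j * b ^ (n ∸ toℕ j) * (x ^ toℕ j * y ^ (n ∸ toℕ j))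
    term j = begin
      (n C toℕ j) ×ₘ ((a * x) ^ toℕ j * (b * y) ^ (n ∸ toℕ j))
        ≡⟨ ×ₘ≡ℕ→ℚ* (n C toℕ j) _ ⟩
      ℕ→ℚ (n C toℕ j) * ((a * x) ^ toℕ j * (b * y) ^ (n ∸ toℕ j))
        ≡⟨ cong (ℕ→ℚ (n C toℕ j) *_) (cong₂ _*_ (^-distrib-* a x (toℕ j)) (^-distrib-* b y (n ∸ toℕ j))) ⟩
      ℕ→ℚ (n C toℕ j) * ((a ^ toℕ j * x ^ toℕ j) * (b ^ (n ∸ toℕ j) * y ^ (n ∸ toℕ j)))
        ≡⟨ shuffle (ℕ→ℚ (n C toℕ j)) (a ^ toℕ j) (x ^ toℕ j) (b ^ (n ∸ toℕ j)) (y ^ (n ∸ toℕ j)) ⟩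
      ℕ→ℚ (n C toℕ j) * a ^ toℕ j * b ^ (n ∸ toℕ j) * (x ^ toℕ j * y ^ (n ∸ toℕ j)) ∎

  -- Evaluation at rational points

  monomial : ℕ → ℚ → ℚ → ℕ → ℚ
  monomial w x y k = x ^ k * y ^ (w ∸ k)

  ev : ∀ {w} → V w → ℚ → ℚ → ℚ
  ev {w} P x y = sumFin (suc w) (λ i → P i * monomial w x y (toℕ i))

  exponent-split : ∀ {w i j l} → i ℕ.≤ w → j ℕ.≤ i → l ℕ.≤ w ∸ i →
    w ∸ (j ℕ.+ l) ≡ (i ∸ j) ℕ.+ ((w ∸ i) ∸ l)
  exponent-split {w} {i} {j} {l} i≤w j≤i l≤w∸i = begin
    w ∸ (j ℕ.+ l)                   ≡⟨ sym (ℕₚ.∸-+-assoc w j l) ⟩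
    (w ∸ j) ∸ l                     ≡⟨ cong (λ n → (n ∸ j) ∸ l) (sym (ℕₚ.m+[n∸m]≡n i≤w)) ⟩
    ((i ℕ.+ (w ∸ i)) ∸ j) ∸ l       ≡⟨ cong (_∸ l) (ℕₚ.+-∸-comm (w ∸ i) j≤i) ⟩
    ((i ∸ j) ℕ.+ (w ∸ i)) ∸ l       ≡⟨ ℕₚ.+-∸-assoc (i ∸ j) l≤w∸i ⟩
    (i ∸ j) ℕ.+ ((w ∸ i) ∸ l)       ∎

  -- The equation is required only where the guard holds, because recombining j and k ∸ j into k is
  -- valid only for j ≤ k.
  if-*-cong : ∀ b p q r → (T b → p * r ≡ q) → (if b then p else 0ℚ) * r ≡ (if b then q else 0ℚ)
  if-*-cong true  p q r eq = eq _
  if-*-cong false p q r eq = *-zeroˡ r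

  -- `actCoef` is the convolution of the coefficients of two binomial expansions. Exchanging the
  -- sums and substituting k = j + l separates it into the product of these expansions.
  ev-actCoef : ∀ a b c d w i x y → i ℕ.≤ w →
    sumFin (suc w) (λ k → actCoef (mat a b c d) w i (toℕ k) * monomial w x y (toℕ k))
    ≡ (ℤ→ℚ a * x + ℤ→ℚ b * y) ^ i * (ℤ→ℚ c * x + ℤ→ℚ d * y) ^ (w ∸ i)
  ev-actCoef a b c d w i x y i≤w = begin
    sumFin (suc w) (λ k → actCoef (mat a b c d) w i (toℕ k) * monomial w x y (toℕ k))
      ≡⟨ sumFin-cong (suc w) (λ k → trans (cong (_* monomial w x y (toℕ k)) (sumTo≡sumFin i (G (toℕ k))))
           (trans (sym (sumFin-*ʳ (suc i) (monomial w x y (toℕ k)) (G (toℕ k) ∘ toℕ)))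
             (sumFin-cong (suc i) (λ j → guarded (toℕ j) (toℕ k))))) ⟩
    sumFin (suc w) (λ k → sumFin (suc i) (λ j → if toℕ j ≤ᵇ toℕ k then F (toℕ j) (toℕ k ∸ toℕ j) else 0ℚ))
      ≡⟨ sumFin-swap (suc w) (suc i) (λ k j → if toℕ j ≤ᵇ toℕ k then F (toℕ j) (toℕ k ∸ toℕ j) else 0ℚ) ⟩
    sumFin (suc i) (λ j → sumFin (suc w) (λ k → if toℕ j ≤ᵇ toℕ k then F (toℕ j) (toℕ k ∸ toℕ j) else 0ℚ))
      ≡⟨ sumFin-cong (suc i) (λ j → inner (toℕ j) (toℕ≤pred[n] j)) ⟩
    sumFin (suc i) (λ j → sumFin (suc m) (λ l → t (toℕ j) * monomial i x y (toℕ j) * (s (toℕ l) * monomial m x y (toℕ l))))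
      ≡⟨ sumFin-product (suc i) (suc m) (λ j → t (toℕ j) * monomial i x y (toℕ j)) (λ l → s (toℕ l) * monomial m x y (toℕ l)) ⟩
    sumFin (suc i) (λ j → t (toℕ j) * monomial i x y (toℕ j)) * sumFin (suc m) (λ l → s (toℕ l) * monomial m x y (toℕ l))
      ≡⟨ cong₂ _*_ (sym (binomial-expansion i (ℤ→ℚ a) (ℤ→ℚ b) x y)) (sym (binomial-expansion m (ℤ→ℚ c) (ℤ→ℚ d) x y)) ⟩
    (ℤ→ℚ a * x + ℤ→ℚ b * y) ^ i * (ℤ→ℚ c * x + ℤ→ℚ d * y) ^ m ∎
    where
    m : ℕ
    m = w ∸ i
    t s : ℕ → ℚ
    t j = ℕ→ℚ (i C j) * ℤ→ℚ a ^ j * ℤ→ℚ b ^ (i ∸ j)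
    s l = ℕ→ℚ (m C l) * ℤ→ℚ c ^ l * ℤ→ℚ d ^ (m ∸ l)
    F : ℕ → ℕ → ℚ
    F j l = t j * s l * monomial w x y (j ℕ.+ l)

    G : ℕ → ℕ → ℚ
    G k j = if j ≤ᵇ k
      then ℕ→ℚ (i C j) * ℤ→ℚ (a ℤ.^ j) * ℤ→ℚ (b ℤ.^ (i ∸ j))
           * ℕ→ℚ (m C (k ∸ j)) * ℤ→ℚ (c ℤ.^ (k ∸ j)) * ℤ→ℚ (d ℤ.^ (m ∸ (k ∸ j)))
      else 0ℚ

    assoc : ∀ p q r u v z → p * q * r * u * v * z ≡ p * q * r * (u * v * z)
    assoc = solve-∀ ring

    guarded : ∀ j k → G k j * monomial w x y k ≡ (if j ≤ᵇ k then F j (k ∸ j) else 0ℚ)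
    guarded j k = if-*-cong (j ≤ᵇ k) _ (F j (k ∸ j)) (monomial w x y k) (λ j≤k → cong₂ _*_
      (trans
        (cong₂ _*_ (cong₂ _*_ (cong (_* ℕ→ℚ (m C (k ∸ j)))
          (cong₂ _*_ (cong (ℕ→ℚ (i C j) *_) (ℤ→ℚ-^ a j)) (ℤ→ℚ-^ b (i ∸ j))))
          (ℤ→ℚ-^ c (k ∸ j))) (ℤ→ℚ-^ d (m ∸ (k ∸ j))))
        (assoc (ℕ→ℚ (i C j)) (ℤ→ℚ a ^ j) (ℤ→ℚ b ^ (i ∸ j))
               (ℕ→ℚ (m C (k ∸ j))) (ℤ→ℚ c ^ (k ∸ j)) (ℤ→ℚ d ^ (m ∸ (k ∸ j)))))
      (cong (monomial w x y) (sym (ℕₚ.m+[n∸m]≡n (ℕₚ.≤ᵇ⇒≤ j k j≤k)))))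

    vanish : ∀ j l → suc m ℕ.≤ l → F j l ≡ 0ℚ
    vanish j l m<l = trans (cong (λ n → t j * (ℕ→ℚ n * ℤ→ℚ c ^ l * ℤ→ℚ d ^ (m ∸ l)) * monomial w x y (j ℕ.+ l)) (k>n⇒nCk≡0 m<l))
      (lemma (t j) (ℤ→ℚ c ^ l) (ℤ→ℚ d ^ (m ∸ l)) (monomial w x y (j ℕ.+ l)))
      where
      lemma : ∀ p q r u → p * (0ℚ * q * r) * u ≡ 0ℚ
      lemma = solve-∀ ring

    split : ∀ j l → j ℕ.≤ i → l ℕ.≤ m → F j l ≡ t j * monomial i x y j * (s l * monomial m x y l)
    split j l j≤i l≤m = begin
      t j * s l * (x ^ (j ℕ.+ l) * y ^ (w ∸ (j ℕ.+ l)))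
        ≡⟨ cong (λ n → t j * s l * (x ^ (j ℕ.+ l) * y ^ n)) (exponent-split i≤w j≤i l≤m) ⟩
      t j * s l * (x ^ (j ℕ.+ l) * y ^ ((i ∸ j) ℕ.+ (m ∸ l)))
        ≡⟨ cong ((t j * s l) *_) (cong₂ _*_ (^-homo-* x j l) (^-homo-* y (i ∸ j) (m ∸ l))) ⟩
      t j * s l * (x ^ j * x ^ l * (y ^ (i ∸ j) * y ^ (m ∸ l)))
        ≡⟨ lemma (t j) (s l) (x ^ j) (x ^ l) (y ^ (i ∸ j)) (y ^ (m ∸ l)) ⟩
      t j * monomial i x y j * (s l * monomial m x y l) ∎
      where
      lemma : ∀ p q r u v z → p * q * (r * u * (v * z)) ≡ p * (r * v) * (q * (u * z))
      lemma = solve-∀ ring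

    length-split : ∀ j → j ℕ.≤ i → suc w ≡ j ℕ.+ (suc m ℕ.+ (i ∸ j))
    length-split j j≤i = begin
      suc w                             ≡⟨ cong suc (sym (ℕₚ.m∸n+n≡m i≤w)) ⟩
      suc m ℕ.+ i                       ≡⟨ cong (suc m ℕ.+_) (sym (ℕₚ.m∸n+n≡m j≤i)) ⟩
      suc m ℕ.+ ((i ∸ j) ℕ.+ j)         ≡⟨ sym (ℕₚ.+-assoc (suc m) (i ∸ j) j) ⟩
      (suc m ℕ.+ (i ∸ j)) ℕ.+ j         ≡⟨ ℕₚ.+-comm _ j ⟩
      j ℕ.+ (suc m ℕ.+ (i ∸ j))         ∎

    inner : ∀ j → j ℕ.≤ i →
      sumFin (suc w) (λ k → if j ≤ᵇ toℕ k then F j (toℕ k ∸ j) else 0ℚ)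
      ≡ sumFin (suc m) (λ l → t j * monomial i x y j * (s (toℕ l) * monomial m x y (toℕ l)))
    inner j j≤i = begin
      sumFin (suc w) (λ k → if j ≤ᵇ toℕ k then F j (toℕ k ∸ j) else 0ℚ)
        ≡⟨ cong (λ n → sumFin n (λ k → if j ≤ᵇ toℕ k then F j (toℕ k ∸ j) else 0ℚ)) (length-split j j≤i) ⟩
      sumFin (j ℕ.+ (suc m ℕ.+ (i ∸ j))) (λ k → if j ≤ᵇ toℕ k then F j (toℕ k ∸ j) else 0ℚ)
        ≡⟨ sumFin-shift j (suc m ℕ.+ (i ∸ j)) (F j) ⟩
      sumFin (suc m ℕ.+ (i ∸ j)) (F j ∘ toℕ)
        -- For fixed j the index l runs up to w - j, which exceeds m = w - i by i - j; the binomial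
        -- coefficient C(m , l) vanishes on this excess.
        ≡⟨ sumFin-truncate (suc m) (i ∸ j) (F j) (vanish j) ⟩
      sumFin (suc m) (F j ∘ toℕ)
        ≡⟨ sumFin-cong (suc m) (λ l → split j (toℕ l) j≤i (toℕ≤pred[n] l)) ⟩
      sumFin (suc m) (λ l → t j * monomial i x y j * (s (toℕ l) * monomial m x y (toℕ l))) ∎

  ev-∣ : ∀ {w} (P : V w) a b c d x y →
    ev (P ∣ mat a b c d) x y ≡ ev P (ℤ→ℚ a * x + ℤ→ℚ b * y) (ℤ→ℚ c * x + ℤ→ℚ d * y)
  ev-∣ {w} P a b c d x y = begin
    sumFin (suc w) (λ k → sumFin (suc w) (λ i → P i * α i k) * μ k)
      ≡⟨ sumFin-cong (suc w) (λ k → sym (sumFin-*ʳ (suc w) (μ k) (λ i → P i * α i k))) ⟩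
    sumFin (suc w) (λ k → sumFin (suc w) (λ i → P i * α i k * μ k))
      ≡⟨ sumFin-swap (suc w) (suc w) (λ k i → P i * α i k * μ k) ⟩
    sumFin (suc w) (λ i → sumFin (suc w) (λ k → P i * α i k * μ k))
      ≡⟨ sumFin-cong (suc w) (λ i → trans (sumFin-cong (suc w) (λ k → *-assoc (P i) (α i k) (μ k)))
           (trans (sumFin-*ˡ (suc w) (P i) (λ k → α i k * μ k)) (cong (P i *_) (ev-actCoef a b c d w (toℕ i) x y (toℕ≤pred[n] i))))) ⟩
    ev P (ℤ→ℚ a * x + ℤ→ℚ b * y) (ℤ→ℚ c * x + ℤ→ℚ d * y) ∎
    where
    α : Fin (suc w) → Fin (suc w) → ℚ
    α i k = actCoef (mat a b c d) w (toℕ i) (toℕ k)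
    μ : Fin (suc w) → ℚ
    μ k = monomial w x y (toℕ k)

  ev-cong : ∀ {w} {P Q : V w} → P ≈ Q → ∀ x y → ev P x y ≡ ev Q x y
  ev-cong {w} P≈Q x y = sumFin-cong (suc w) (λ i → cong (_* monomial w x y (toℕ i)) (P≈Q i))

  ev-⊕ : ∀ {w} (P Q : V w) x y → ev (P ⊕ Q) x y ≡ ev P x y + ev Q x y
  ev-⊕ {w} P Q x y = trans
    (sumFin-cong (suc w) (λ i → *-distribʳ-+ (monomial w x y (toℕ i)) (P i) (Q i)))
    (sumFin-+ (suc w) (λ i → P i * monomial w x y (toℕ i)) (λ i → Q i * monomial w x y (toℕ i)))

  ev-⊛ : ∀ {w} c (P : V w) x y → ev (c ⊛ P) x y ≡ c * ev P x y
  ev-⊛ {w} c P x y = trans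
    (sumFin-cong (suc w) (λ i → *-assoc c (P i) (monomial w x y (toℕ i))))
    (sumFin-*ˡ (suc w) c (λ i → P i * monomial w x y (toℕ i)))

  ev-zeroV : ∀ {w} x y → ev (zeroV {w}) x y ≡ 0ℚ
  ev-zeroV {w} x y = trans
    (sumFin-cong (suc w) (λ i → *-zeroˡ (monomial w x y (toℕ i)))) (sumFin-0 (suc w))

  ev-lincomb : ∀ {w n} (c : Fin n → ℚ) (b : Fin n → V w) x y →
    ev (lincomb c b) x y ≡ sumFin n (λ i → c i * ev (b i) x y)
  ev-lincomb {w} {zero}  c b x y = ev-zeroV {w} x y
  ev-lincomb {w} {suc n} c b x y = begin
    ev (lincomb c b) x y
      ≡⟨ ev-⊕ (c fzero ⊛ b fzero) (lincomb (c ∘ fsuc) (b ∘ fsuc)) x y ⟩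
    ev (c fzero ⊛ b fzero) x y + ev (lincomb (c ∘ fsuc) (b ∘ fsuc)) x y
      ≡⟨ cong₂ _+_ (ev-⊛ (c fzero) (b fzero) x y) (ev-lincomb (c ∘ fsuc) (b ∘ fsuc) x y) ⟩
    sumFin (suc n) (λ i → c i * ev (b i) x y) ∎

  -- Division by linear forms, and forms determined by their values

  1^n≡1 : ∀ n → 1ℚ ^ n ≡ 1ℚ
  1^n≡1 zero    = refl
  1^n≡1 (suc n) = trans (*-identityˡ (1ℚ ^ n)) (1^n≡1 n)

  ev-const : ∀ (P : V 0) x y → ev P x y ≡ P fzero
  ev-const P x y = lemma (P fzero)
    where
    lemma : ∀ p → p * (1ℚ * 1ℚ) + 0ℚ ≡ p
    lemma = solve-∀ ring

  ev-horner : ∀ {n} (P : V (suc n)) x y →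
    ev P x y ≡ P fzero * y ^ suc n + x * ev (P ∘ fsuc) x y
  ev-horner {n} P x y = cong₂ _+_ (cong (P fzero *_) (*-identityˡ (y ^ suc n))) (trans
    (sumFin-cong (suc n) (λ i → lemma (P (fsuc i)) x (x ^ toℕ i) (y ^ (n ∸ toℕ i))))
    (sumFin-*ˡ (suc n) x (λ i → P (fsuc i) * monomial n x y (toℕ i))))
    where
    lemma : ∀ p x a b → p * (x * a * b) ≡ x * (p * (a * b))
    lemma = solve-∀ ring

  ev[0,1] : ∀ {w} (P : V w) → ev P 0ℚ 1ℚ ≡ P fzero
  ev[0,1] {zero}  P = ev-const P 0ℚ 1ℚ
  ev[0,1] {suc n} P = trans (ev-horner P 0ℚ 1ℚ)
    (trans (cong (λ u → P fzero * u + 0ℚ * ev (P ∘ fsuc) 0ℚ 1ℚ) (1^n≡1 (suc n)))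
           (lemma (P fzero) (ev (P ∘ fsuc) 0ℚ 1ℚ)))
    where
    lemma : ∀ p q → p * 1ℚ + 0ℚ * q ≡ p
    lemma = solve-∀ ring

  -- Synthetic division by X - rY: the i-th coefficient is the value at (r , 1) of the form left
  -- after dropping the lowest i + 1 coefficients.
  quotient : ∀ {n} → ℚ → V (suc n) → V n
  quotient r P fzero              = ev (P ∘ fsuc) r 1ℚ
  quotient {suc n} r P (fsuc i)   = quotient r (P ∘ fsuc) i

  ev-quotient : ∀ {n} r (P : V (suc n)) x y →
    ev P x y ≡ ev P r 1ℚ * y ^ suc n + (x - r * y) * ev (quotient r P) x y
  ev-quotient {zero} r P x y = begin
    ev P x y
      ≡⟨ ev-horner P x y ⟩
    P fzero * (y * 1ℚ) + x * ev (P ∘ fsuc) x y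
      ≡⟨ cong (λ e → P fzero * (y * 1ℚ) + x * e) (ev-const (P ∘ fsuc) x y) ⟩
    P fzero * (y * 1ℚ) + x * p₁
      ≡⟨ lemma (P fzero) p₁ r x y ⟩
    (P fzero * (1ℚ * 1ℚ) + r * p₁) * (y * 1ℚ) + (x - r * y) * p₁
      ≡⟨ cong₂ (λ e q → (P fzero * (1ℚ * 1ℚ) + r * e) * (y * 1ℚ) + (x - r * y) * q)
           (sym (ev-const (P ∘ fsuc) r 1ℚ))
           (sym (trans (ev-const (quotient r P) x y) (ev-const (P ∘ fsuc) r 1ℚ))) ⟩
    (P fzero * (1ℚ * 1ℚ) + r * ev (P ∘ fsuc) r 1ℚ) * (y * 1ℚ) + (x - r * y) * ev (quotient r P) x y
      ≡⟨ cong (λ e → e * (y * 1ℚ) + (x - r * y) * ev (quotient r P) x y) (sym (ev-horner P r 1ℚ)) ⟩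
    ev P r 1ℚ * (y * 1ℚ) + (x - r * y) * ev (quotient r P) x y ∎
    where
    p₁ : ℚ
    p₁ = P (fsuc fzero)
    lemma : ∀ p q r x y → p * (y * 1ℚ) + x * q ≡ (p * (1ℚ * 1ℚ) + r * q) * (y * 1ℚ) + (x - r * y) * q
    lemma = solve-∀ ring
  ev-quotient {suc n} r P x y = begin
    ev P x y
      ≡⟨ ev-horner P x y ⟩
    P fzero * (y * Y) + x * ev P′ x y
      ≡⟨ cong (λ e → P fzero * (y * Y) + x * e) (ev-quotient r P′ x y) ⟩
    P fzero * (y * Y) + x * (e * Y + (x - r * y) * q)
      ≡⟨ lemma (P fzero) e q r x y Y ⟩
    (P fzero * 1ℚ + r * e) * (y * Y) + (x - r * y) * (e * Y + x * q)
      ≡⟨ cong₂ (λ u v → (P fzero * u + r * e) * (y * Y) + (x - r * y) * v)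
           (sym (1^n≡1 (suc (suc n)))) (sym (ev-horner (quotient r P) x y)) ⟩
    (P fzero * 1ℚ ^ suc (suc n) + r * e) * (y * Y) + (x - r * y) * ev (quotient r P) x y
      ≡⟨ cong (λ u → u * (y * Y) + (x - r * y) * ev (quotient r P) x y) (sym (ev-horner P r 1ℚ)) ⟩
    ev P r 1ℚ * (y * Y) + (x - r * y) * ev (quotient r P) x y ∎
    where
    P′ : V (suc n)
    P′ = P ∘ fsuc
    Y e q : ℚ
    Y = y ^ suc n
    e = ev P′ r 1ℚ
    q = ev (quotient r P′) x y
    lemma : ∀ p e q r x y Y → p * (y * Y) + x * (e * Y + (x - r * y) * q)
      ≡ (p * 1ℚ + r * e) * (y * Y) + (x - r * y) * (e * Y + x * q)
    lemma = solve-∀ ring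

  ev-root : ∀ {n} r (P : V (suc n)) → ev P r 1ℚ ≡ 0ℚ → ∀ x y → ev P x y ≡ (x - r * y) * ev (quotient r P) x y
  ev-root {n} r P Pr≡0 x y = trans (ev-quotient r P x y)
    (trans (cong (λ e → e * y ^ suc n + (x - r * y) * ev (quotient r P) x y) Pr≡0)
           (lemma (y ^ suc n) ((x - r * y) * ev (quotient r P) x y)))
    where
    lemma : ∀ p q → 0ℚ * p + q ≡ q
    lemma = solve-∀ ring

  *-cancel-≢0 : ∀ {p q r} → p ≢ 0ℚ → p * q ≡ p * r → q ≡ r
  *-cancel-≢0 {p} {q} {r} p≢0 pq≡pr = trans (sym (inv q)) (trans (cong (1/ p *_) pq≡pr) (inv r))
    where
    instance _ = ≢-nonZero p≢0
    inv : ∀ u → 1/ p * (p * u) ≡ u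
    inv u = trans (sym (*-assoc (1/ p) p u)) (trans (cong (_* u) (*-inverseˡ p)) (*-identityˡ u))

  *-≡0 : ∀ {p q} → p ≢ 0ℚ → p * q ≡ 0ℚ → q ≡ 0ℚ
  *-≡0 {p} {q} p≢0 pq≡0 = *-cancel-≢0 {p} {q} {0ℚ} p≢0 (trans pq≡0 (sym (*-zeroʳ p)))

  p+-1*p≡0 : ∀ p → p + - 1ℚ * p ≡ 0ℚ
  p+-1*p≡0 = solve-∀ ring

  -≡0⇒≡ : ∀ p q → p + - 1ℚ * q ≡ 0ℚ → p ≡ q
  -≡0⇒≡ p q eq = trans (lemma p q) (trans (cong (_+ q) eq) (+-identityˡ q))
    where
    lemma : ∀ p q → p ≡ (p + - 1ℚ * q) + q
    lemma = solve-∀ ring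

  <⇒-≢0 : ∀ {r x} → r < x → x - r * 1ℚ ≢ 0ℚ
  <⇒-≢0 {r} {x} r<x eq = <-irrefl (sym (-≡0⇒≡ x r (trans (lemma x r) eq))) r<x
    where
    lemma : ∀ x r → x + - 1ℚ * r ≡ x - r * 1ℚ
    lemma = solve-∀ ring

  x<x+1 : ∀ x → x < x + 1ℚ
  x<x+1 x = subst (_< x + 1ℚ) (+-identityʳ x) (+-monoʳ-< x (toWitness {a? = 0ℚ <? 1ℚ} _))

  -- Dividing by X - sY at the root s = r + 1 leaves a quotient that vanishes for all x > s, so
  -- induction on the degree applies with a larger bound. Then P vanishes at every point: the value
  -- at (0 , 1) is its lowest coefficient, and after division by x > 0 the remaining coefficients
  -- form a vanishing form of smaller degree, to which the induction applies again.
  ev-vanishing : ∀ n (P : V n) r → (∀ x → r < x → ev P x 1ℚ ≡ 0ℚ) → ∀ i → P i ≡ 0ℚ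
  ev-vanishing zero P r ev≡0 fzero =
    trans (sym (ev-const P (r + 1ℚ) 1ℚ)) (ev≡0 (r + 1ℚ) (x<x+1 r))
  ev-vanishing (suc n) P r ev≡0 = λ { fzero → P₀≡0 ; (fsuc i) → ev-vanishing n (P ∘ fsuc) 0ℚ tail≡0 i }
    where
    s : ℚ
    s = r + 1ℚ
    root : ∀ x y → ev P x y ≡ (x - s * y) * ev (quotient s P) x y
    root = ev-root s P (ev≡0 s (x<x+1 r))
    quotient≡0 : ∀ i → quotient s P i ≡ 0ℚ
    quotient≡0 = ev-vanishing n (quotient s P) s (λ x s<x → *-≡0 (<⇒-≢0 s<x)
      (trans (sym (root x 1ℚ)) (ev≡0 x (<-trans (x<x+1 r) s<x))))
    P≡0 : ∀ x y → ev P x y ≡ 0ℚ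
    P≡0 x y = trans (root x y) (trans
      (cong ((x - s * y) *_) (trans (ev-cong quotient≡0 x y) (ev-zeroV {n} x y))) (*-zeroʳ (x - s * y)))
    P₀≡0 : P fzero ≡ 0ℚ
    P₀≡0 = trans (sym (ev[0,1] P)) (P≡0 0ℚ 1ℚ)
    tail≡0 : ∀ x → 0ℚ < x → ev (P ∘ fsuc) x 1ℚ ≡ 0ℚ
    tail≡0 x 0<x = *-≡0 (λ x≡0 → <-irrefl (sym x≡0) 0<x) (begin
      x * ev (P ∘ fsuc) x 1ℚ
        ≡⟨ lemma (1ℚ ^ suc n) (x * ev (P ∘ fsuc) x 1ℚ) ⟩
      0ℚ * 1ℚ ^ suc n + x * ev (P ∘ fsuc) x 1ℚ
        ≡⟨ cong (λ p → p * 1ℚ ^ suc n + x * ev (P ∘ fsuc) x 1ℚ) (sym P₀≡0) ⟩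
      P fzero * 1ℚ ^ suc n + x * ev (P ∘ fsuc) x 1ℚ
        ≡⟨ sym (ev-horner P x 1ℚ) ⟩
      ev P x 1ℚ
        ≡⟨ P≡0 x 1ℚ ⟩
      0ℚ ∎)
      where
      lemma : ∀ p q → q ≡ 0ℚ * p + q
      lemma = solve-∀ ring

  ev-injective : ∀ {w} (P Q : V w) r → (∀ x → r < x → ev P x 1ℚ ≡ ev Q x 1ℚ) → P ≈ Q
  ev-injective {w} P Q r ev≡ i = -≡0⇒≡ (P i) (Q i) (ev-vanishing w (P ⊕ ((- 1ℚ) ⊛ Q)) r difference≡0 i)
    where
    difference≡0 : ∀ x → r < x → ev (P ⊕ ((- 1ℚ) ⊛ Q)) x 1ℚ ≡ 0ℚ
    difference≡0 x r<x = begin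
      ev (P ⊕ ((- 1ℚ) ⊛ Q)) x 1ℚ            ≡⟨ ev-⊕ P ((- 1ℚ) ⊛ Q) x 1ℚ ⟩
      ev P x 1ℚ + ev ((- 1ℚ) ⊛ Q) x 1ℚ      ≡⟨ cong₂ _+_ (ev≡ x r<x) (ev-⊛ (- 1ℚ) Q x 1ℚ) ⟩
      ev Q x 1ℚ + - 1ℚ * ev Q x 1ℚ          ≡⟨ p+-1*p≡0 (ev Q x 1ℚ) ⟩
      0ℚ                                    ∎

  ev-∣-at : ∀ {w} (P : V w) a b c d x y {p q} →
    ℤ→ℚ a * x + ℤ→ℚ b * y ≡ p → ℤ→ℚ c * x + ℤ→ℚ d * y ≡ q →
    ev (P ∣ mat a b c d) x y ≡ ev P p q
  ev-∣-at P a b c d x y p≡ q≡ = trans (ev-∣ P a b c d x y) (cong₂ (ev P) p≡ q≡)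

  -- The substitutions defined by the matrices of the relations

  form₁₀ : ∀ x y → 1ℚ * x + 0ℚ * y ≡ x
  form₁₀ = solve-∀ ring

  form₀₁ : ∀ x y → 0ℚ * x + 1ℚ * y ≡ y
  form₀₁ = solve-∀ ring

  form₁₁ : ∀ x y → 1ℚ * x + 1ℚ * y ≡ x + y
  form₁₁ = solve-∀ ring

  form₋₀ : ∀ x y → - 1ℚ * x + 0ℚ * y ≡ - x
  form₋₀ = solve-∀ ring

  form₀₋ : ∀ x y → 0ℚ * x + - 1ℚ * y ≡ - y
  form₀₋ = solve-∀ ring

  form₋₋ : ∀ x y → - 1ℚ * x + - 1ℚ * y ≡ - x - y
  form₋₋ = solve-∀ ring

  form₋₁ : ∀ x y → - 1ℚ * x + 1ℚ * y ≡ y - x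
  form₋₁ = solve-∀ ring

  module _ {w} (P : V w) (x y : ℚ) where

    ev-δ : ev (P ∣ δ) x y ≡ ev P x (- y)
    ev-δ = ev-∣-at P _ _ _ _ x y (form₁₀ x y) (form₀₋ x y)

    ev-ε : ev (P ∣ ε) x y ≡ ev P y x
    ev-ε = ev-∣-at P _ _ _ _ x y (form₀₁ x y) (form₁₀ x y)

    ev-T₁ : ev (P ∣ T₁) x y ≡ ev P x (x + y)
    ev-T₁ = ev-∣-at P _ _ _ _ x y (form₁₀ x y) (form₁₁ x y)

    ev-T₂ : ev (P ∣ T₂) x y ≡ ev P y (x + y)
    ev-T₂ = ev-∣-at P _ _ _ _ x y (form₀₁ x y) (form₁₁ x y)

    ev-S : ev (P ∣ S) x y ≡ ev P (- y) (- x)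
    ev-S = ev-∣-at P _ _ _ _ x y (form₀₋ x y) (form₋₀ x y)

    ev-ε′ : ev (P ∣ ε′) x y ≡ ev P (- y) (- x)
    ev-ε′ = ev-∣-at P _ _ _ _ x y (form₀₋ x y) (form₋₀ x y)

    ev-γ′ : ev (P ∣ γ′) x y ≡ ev P y (- x - y)
    ev-γ′ = ev-∣-at P _ _ _ _ x y (form₀₁ x y) (form₋₋ x y)

    ev-γ′² : ev (P ∣ (γ′ · γ′)) x y ≡ ev P (- x - y) x
    ev-γ′² = ev-∣-at P _ _ _ _ x y (form₋₋ x y) (form₁₀ x y)

  -- The relations of LSh and W at a point

  LShAt WAt : (ℚ → ℚ → ℚ) → ℚ → ℚ → Set
  LShAt F x y = (F x (x + y) + F y (x + y) ≡ - 1ℚ * F x (- y)) × F x y ≡ F (- y) (- x)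
  WAt   F x y = F x y ≡ F (- y) (- x) × ((F x y + F y (- x - y)) + F (- x - y) x ≡ 0ℚ)

  InLSh⇒LShAt : ∀ {w} (P : V w) → InLSh w P → ∀ x y → LShAt (ev P) x y
  InLSh⇒LShAt {w} P (shuffle , symmetric) x y =
    (begin
      ev P x (x + y) + ev P y (x + y)       ≡⟨ cong₂ _+_ (sym (ev-T₁ P x y)) (sym (ev-T₂ P x y)) ⟩
      ev (P ∣ T₁) x y + ev (P ∣ T₂) x y     ≡⟨ sym (ev-⊕ (P ∣ T₁) (P ∣ T₂) x y) ⟩
      ev ((P ∣ T₁) ⊕ (P ∣ T₂)) x y          ≡⟨ ev-cong shuffle x y ⟩
      ev ((- 1ℚ) ⊛ (P ∣ δ)) x y             ≡⟨ ev-⊛ (- 1ℚ) (P ∣ δ) x y ⟩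
      - 1ℚ * ev (P ∣ δ) x y                 ≡⟨ cong (- 1ℚ *_) (ev-δ P x y) ⟩
      - 1ℚ * ev P x (- y)                   ∎) ,
    trans (ev-cong symmetric x y) (ev-S P x y)

  LShAt⇒InLSh : ∀ {w} (P : V w) r → (∀ x → r < x → LShAt (ev P) x 1ℚ) → InLSh w P
  LShAt⇒InLSh {w} P r at =
    ev-injective ((P ∣ T₁) ⊕ (P ∣ T₂)) ((- 1ℚ) ⊛ (P ∣ δ)) r (λ x r<x → begin
      ev ((P ∣ T₁) ⊕ (P ∣ T₂)) x 1ℚ         ≡⟨ ev-⊕ (P ∣ T₁) (P ∣ T₂) x 1ℚ ⟩
      ev (P ∣ T₁) x 1ℚ + ev (P ∣ T₂) x 1ℚ   ≡⟨ cong₂ _+_ (ev-T₁ P x 1ℚ) (ev-T₂ P x 1ℚ) ⟩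
      ev P x (x + 1ℚ) + ev P 1ℚ (x + 1ℚ)    ≡⟨ proj₁ (at x r<x) ⟩
      - 1ℚ * ev P x (- 1ℚ)                  ≡⟨ cong (- 1ℚ *_) (sym (ev-δ P x 1ℚ)) ⟩
      - 1ℚ * ev (P ∣ δ) x 1ℚ                ≡⟨ sym (ev-⊛ (- 1ℚ) (P ∣ δ) x 1ℚ) ⟩
      ev ((- 1ℚ) ⊛ (P ∣ δ)) x 1ℚ            ∎) ,
    ev-injective P (P ∣ S) r (λ x r<x → trans (proj₂ (at x r<x)) (sym (ev-S P x 1ℚ)))

  ev-W₁ : ∀ {w} (Q : V w) x y → ev (Q ⊕ ((- 1ℚ) ⊛ (Q ∣ ε′))) x y ≡ ev Q x y + - 1ℚ * ev Q (- y) (- x)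
  ev-W₁ Q x y = trans (ev-⊕ Q ((- 1ℚ) ⊛ (Q ∣ ε′)) x y)
    (cong (ev Q x y +_) (trans (ev-⊛ (- 1ℚ) (Q ∣ ε′) x y) (cong (- 1ℚ *_) (ev-ε′ Q x y))))

  ev-W₂ : ∀ {w} (Q : V w) x y → ev ((Q ⊕ (Q ∣ γ′)) ⊕ (Q ∣ (γ′ · γ′))) x y
    ≡ (ev Q x y + ev Q y (- x - y)) + ev Q (- x - y) x
  ev-W₂ Q x y = trans (ev-⊕ (Q ⊕ (Q ∣ γ′)) (Q ∣ (γ′ · γ′)) x y) (cong₂ _+_
    (trans (ev-⊕ Q (Q ∣ γ′) x y) (cong (ev Q x y +_) (ev-γ′ Q x y)))
    (ev-γ′² Q x y))

  InW⇒WAt : ∀ {w} (Q : V w) → InW w Q → ∀ x y → WAt (ev Q) x y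
  InW⇒WAt {w} Q (symmetric , cyclic) x y =
    -≡0⇒≡ (ev Q x y) (ev Q (- y) (- x))
      (trans (sym (ev-W₁ Q x y)) (trans (ev-cong symmetric x y) (ev-zeroV {w} x y))) ,
    trans (sym (ev-W₂ Q x y)) (trans (ev-cong cyclic x y) (ev-zeroV {w} x y))

  WAt⇒InW : ∀ {w} (Q : V w) → (∀ x y → WAt (ev Q) x y) → InW w Q
  WAt⇒InW {w} Q at =
    ev-vanishing w (Q ⊕ ((- 1ℚ) ⊛ (Q ∣ ε′))) 0ℚ (λ x _ → trans (ev-W₁ Q x 1ℚ)
      (trans (cong (λ e → e + - 1ℚ * ev Q (- 1ℚ) (- x)) (proj₁ (at x 1ℚ))) (p+-1*p≡0 (ev Q (- 1ℚ) (- x))))) ,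
    ev-vanishing w ((Q ⊕ (Q ∣ γ′)) ⊕ (Q ∣ (γ′ · γ′))) 0ℚ (λ x _ → trans (ev-W₂ Q x 1ℚ) (proj₂ (at x 1ℚ)))

  -- Homogeneity, parity, and the passage from LSh to W in even degree

  ev-homogeneous : ∀ {w} (P : V w) t x y → ev P (t * x) (t * y) ≡ t ^ w * ev P x y
  ev-homogeneous {w} P t x y = trans
    (sumFin-cong (suc w) (λ i → term (P i) (toℕ i) (toℕ≤pred[n] i)))
    (sumFin-*ˡ (suc w) (t ^ w) (λ i → P i * monomial w x y (toℕ i)))
    where
    term : ∀ p k → k ℕ.≤ w → p * monomial w (t * x) (t * y) k ≡ t ^ w * (p * monomial w x y k)
    term p k k≤w = begin
      p * ((t * x) ^ k * (t * y) ^ (w ∸ k))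
        ≡⟨ cong (p *_) (cong₂ _*_ (^-distrib-* t x k) (^-distrib-* t y (w ∸ k))) ⟩
      p * ((t ^ k * x ^ k) * (t ^ (w ∸ k) * y ^ (w ∸ k)))
        ≡⟨ lemma p (t ^ k) (t ^ (w ∸ k)) (x ^ k) (y ^ (w ∸ k)) ⟩
      (t ^ k * t ^ (w ∸ k)) * (p * monomial w x y k)
        ≡⟨ cong (_* (p * monomial w x y k)) (trans (sym (^-homo-* t k (w ∸ k))) (cong (t ^_) (ℕₚ.m+[n∸m]≡n k≤w))) ⟩
      t ^ w * (p * monomial w x y k) ∎
      where
      lemma : ∀ p a b c d → p * ((a * c) * (b * d)) ≡ (a * b) * (p * (c * d))
      lemma = solve-∀ ring

  -1^even : ∀ w → w % 2 ≡ 0 → (- 1ℚ) ^ w ≡ 1ℚ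
  -1^even w even = begin
    (- 1ℚ) ^ w                   ≡⟨ cong ((- 1ℚ) ^_) (trans (m≡m%n+[m/n]*n w 2) (trans (cong (ℕ._+ w ℕ./ 2 ℕ.* 2) even) (ℕₚ.*-comm (w ℕ./ 2) 2))) ⟩
    (- 1ℚ) ^ (2 ℕ.* (w ℕ./ 2))   ≡⟨ sym (^-assocʳ (- 1ℚ) 2 (w ℕ./ 2)) ⟩
    1ℚ ^ (w ℕ./ 2)               ≡⟨ 1^n≡1 (w ℕ./ 2) ⟩
    1ℚ                           ∎

  -‿involutive : ∀ x → - (- x) ≡ x
  -‿involutive = solve-∀ ring

  ev-even : ∀ {w} → w % 2 ≡ 0 → (P : V w) → ∀ x y → ev P (- x) (- y) ≡ ev P x y
  ev-even {w} even P x y = begin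
    ev P (- x) (- y)                   ≡⟨ cong₂ (ev P) (lemma x) (lemma y) ⟩
    ev P (- 1ℚ * x) (- 1ℚ * y)         ≡⟨ ev-homogeneous P (- 1ℚ) x y ⟩
    (- 1ℚ) ^ w * ev P x y              ≡⟨ cong (_* ev P x y) (-1^even w even) ⟩
    1ℚ * ev P x y                      ≡⟨ *-identityˡ (ev P x y) ⟩
    ev P x y                           ∎
    where
    lemma : ∀ x → - x ≡ - 1ℚ * x
    lemma = solve-∀ ring

  ∣δ-involutive : ∀ {w} (P : V w) → ((P ∣ δ) ∣ δ) ≈ P
  ∣δ-involutive P = ev-injective ((P ∣ δ) ∣ δ) P 0ℚ (λ x _ →
    trans (ev-δ (P ∣ δ) x 1ℚ) (trans (ev-δ P x (- 1ℚ)) (cong (ev P x) (-‿involutive 1ℚ))))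

  ∣δ-injective : ∀ {w} (P P′ : V w) → (P ∣ δ) ≈ (P′ ∣ δ) → P ≈ P′
  ∣δ-injective P P′ eq = ev-injective P P′ 0ℚ (λ x _ → begin
    ev P x 1ℚ              ≡⟨ cong (ev P x) (sym (-‿involutive 1ℚ)) ⟩
    ev P x (- (- 1ℚ))      ≡⟨ sym (ev-δ P x (- 1ℚ)) ⟩
    ev (P ∣ δ) x (- 1ℚ)    ≡⟨ ev-cong eq x (- 1ℚ) ⟩
    ev (P′ ∣ δ) x (- 1ℚ)   ≡⟨ ev-δ P′ x (- 1ℚ) ⟩
    ev P′ x (- (- 1ℚ))     ≡⟨ cong (ev P′ x) (-‿involutive 1ℚ) ⟩
    ev P′ x 1ℚ             ∎)

  neg-sum : ∀ x y → - (- x - y) ≡ x + y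
  neg-sum = solve-∀ ring

  sum-neg : ∀ x y → - (x + y) ≡ - x - y
  sum-neg = solve-∀ ring

  -- P ↦ P|δ identifies LSh with the space U of all G satisfying UAt, in every degree;
  -- U and W differ only by the sign (-1)ʷ in the first relation.
  UAt : (ℚ → ℚ → ℚ) → ℚ → ℚ → Set
  UAt G x y = G x y ≡ G y x × ((G x y + G y (- x - y)) + G (- x - y) x ≡ 0ℚ)

  -- With z = - x - y, the value F(y , x + y) is G(y , z), and F(x , x + y) is G(x , z), hence G(z ,
  -- x) by symmetry. The shuffle relation is thus the cyclic relation with G(x , y) moved to the
  -- other side.
  InLSh⇒UAt : ∀ {w} (P : V w) → InLSh w P → ∀ x y → UAt (ev (P ∣ δ)) x y
  InLSh⇒UAt {w} P P∈LSh x y = symmetric , cyclic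
    where
    F G : ℚ → ℚ → ℚ
    F = ev P
    G = ev (P ∣ δ)
    symmetric : G x y ≡ G y x
    symmetric = begin
      G x y                ≡⟨ ev-δ P x y ⟩
      F x (- y)            ≡⟨ proj₂ (InLSh⇒LShAt P P∈LSh x (- y)) ⟩
      F (- (- y)) (- x)    ≡⟨ cong (λ u → F u (- x)) (-‿involutive y) ⟩
      F y (- x)            ≡⟨ sym (ev-δ P y x) ⟩
      G y x                ∎
    cyclic : (G x y + G y (- x - y)) + G (- x - y) x ≡ 0ℚ
    cyclic = begin
      (G x y + G y (- x - y)) + G (- x - y) x
        ≡⟨ cong₂ _+_ (cong₂ _+_ (ev-δ P x y) (trans (ev-δ P y (- x - y)) (cong (F y) (neg-sum x y))))
             (trans (ev-δ P (- x - y) x) (sym (trans (proj₂ (InLSh⇒LShAt P P∈LSh x (x + y)))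
               (cong (λ u → F u (- x)) (sum-neg x y))))) ⟩
      (F x (- y) + F y (x + y)) + F x (x + y)
        ≡⟨ rotate (F x (- y)) (F y (x + y)) (F x (x + y)) ⟩
      F x (- y) + (F x (x + y) + F y (x + y))
        ≡⟨ cong (F x (- y) +_) (proj₁ (InLSh⇒LShAt P P∈LSh x y)) ⟩
      F x (- y) + - 1ℚ * F x (- y)
        ≡⟨ p+-1*p≡0 (F x (- y)) ⟩
      0ℚ ∎
      where
      rotate : ∀ p q r → (p + q) + r ≡ p + (r + q)
      rotate = solve-∀ ring

  UAt⇒InLSh : ∀ {w} (R : V w) → (∀ x y → UAt (ev R) x y) → InLSh w (R ∣ δ)
  UAt⇒InLSh {w} R at = LShAt⇒InLSh (R ∣ δ) 0ℚ (λ x _ → shuffle x 1ℚ , symmetric x 1ℚ)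
    where
    F H : ℚ → ℚ → ℚ
    F = ev (R ∣ δ)
    H = ev R
    symmetric : ∀ x y → F x y ≡ F (- y) (- x)
    symmetric x y = begin
      F x y                ≡⟨ ev-δ R x y ⟩
      H x (- y)            ≡⟨ proj₁ (at x (- y)) ⟩
      H (- y) x            ≡⟨ cong (H (- y)) (sym (-‿involutive x)) ⟩
      H (- y) (- (- x))    ≡⟨ sym (ev-δ R (- y) (- x)) ⟩
      F (- y) (- x)        ∎
    shuffle : ∀ x y → F x (x + y) + F y (x + y) ≡ - 1ℚ * F x (- y)
    shuffle x y = begin
      F x (x + y) + F y (x + y)
        ≡⟨ cong₂ _+_ (trans (ev-δ R x (x + y)) (trans (cong (H x) (sum-neg x y)) (proj₁ (at x (- x - y)))))
                     (trans (ev-δ R y (x + y)) (cong (H y) (sum-neg x y))) ⟩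
      H (- x - y) x + H y (- x - y)
        ≡⟨ rotate (H x y) (H y (- x - y)) (H (- x - y) x) ⟩
      ((H x y + H y (- x - y)) + H (- x - y) x) + - 1ℚ * H x y
        ≡⟨ cong (_+ - 1ℚ * H x y) (proj₂ (at x y)) ⟩
      0ℚ + - 1ℚ * H x y
        ≡⟨ +-identityˡ (- 1ℚ * H x y) ⟩
      - 1ℚ * H x y
        ≡⟨ cong (- 1ℚ *_) (sym (trans (ev-δ R x (- y)) (cong (H x) (-‿involutive y)))) ⟩
      - 1ℚ * F x (- y) ∎
      where
      rotate : ∀ p q r → r + q ≡ ((p + q) + r) + - 1ℚ * p
      rotate = solve-∀ ring

  LSh∣δ⊆W : ∀ {w} → w % 2 ≡ 0 → (P : V w) → InLSh w P → InW w (P ∣ δ)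
  LSh∣δ⊆W even P P∈LSh = WAt⇒InW (P ∣ δ) (λ x y →
    let u = InLSh⇒UAt P P∈LSh x y
    in trans (proj₁ u) (sym (ev-even even (P ∣ δ) y x)) , proj₂ u)

  W∣δ⊆LSh : ∀ {w} → w % 2 ≡ 0 → (Q : V w) → InW w Q → InLSh w (Q ∣ δ)
  W∣δ⊆LSh even Q Q∈W = UAt⇒InLSh Q (λ x y →
    let q = InW⇒WAt Q Q∈W x y
    in trans (proj₁ q) (ev-even even Q y x) , proj₂ q)

  -- The dimension of LSh

  -- Multiplication by X prepends a zero coefficient, whereas multiplication by Y would append one
  -- at the end; conjugation by the swap `ε` reduces the second to the first.
  mulX mulY : ∀ {n} → V n → V (suc n)
  mulX R = 0ℚ ∷ R
  mulY R = mulX (R ∣ ε) ∣ ε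

  ev-factor-X : ∀ {n} (P : V (suc n)) → P fzero ≡ 0ℚ → ∀ x y → ev P x y ≡ x * ev (P ∘ fsuc) x y
  ev-factor-X {n} P P₀≡0 x y = trans (ev-horner P x y) (trans
    (cong (λ p → p * y ^ suc n + x * ev (P ∘ fsuc) x y) P₀≡0)
    (lemma (y ^ suc n) (x * ev (P ∘ fsuc) x y)))
    where
    lemma : ∀ p q → 0ℚ * p + q ≡ q
    lemma = solve-∀ ring

  ev-mulX : ∀ {n} (R : V n) x y → ev (mulX R) x y ≡ x * ev R x y
  ev-mulX R = ev-factor-X (mulX R) refl

  ev-mulY : ∀ {n} (R : V n) x y → ev (mulY R) x y ≡ y * ev R x y
  ev-mulY R x y = trans (ev-ε (mulX (R ∣ ε)) x y) (trans (ev-mulX (R ∣ ε) y x) (cong (y *_) (ev-ε R y x)))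

  -- With z = - x - y one has Δ(x , - y) = x y z. In the coordinates of G, multiplication by `Δ` is
  -- thus multiplication by a function symmetric in x, y and z, which preserves both relations.
  Δ : ℚ → ℚ → ℚ
  Δ x y = x * (y * (x + - 1ℚ * y))

  mulΔ : ∀ {w} → V w → V (3 ℕ.+ w)
  mulΔ R = mulX (mulY (mulX R ⊕ ((- 1ℚ) ⊛ mulY R)))

  ev-mulΔ : ∀ {w} (R : V w) x y → ev (mulΔ R) x y ≡ Δ x y * ev R x y
  ev-mulΔ R x y = begin
    ev (mulΔ R) x y
      ≡⟨ trans (ev-mulX (mulY M) x y) (cong (x *_) (ev-mulY M x y)) ⟩
    x * (y * ev M x y)
      ≡⟨ cong (λ e → x * (y * e)) (trans (ev-⊕ (mulX R) ((- 1ℚ) ⊛ mulY R) x y)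
           (cong₂ _+_ (ev-mulX R x y) (trans (ev-⊛ (- 1ℚ) (mulY R) x y) (cong (- 1ℚ *_) (ev-mulY R x y))))) ⟩
    x * (y * (x * ev R x y + - 1ℚ * (y * ev R x y)))
      ≡⟨ lemma x y (ev R x y) ⟩
    Δ x y * ev R x y ∎
    where
    M : V _
    M = mulX R ⊕ ((- 1ℚ) ⊛ mulY R)
    lemma : ∀ x y e → x * (y * (x * e + - 1ℚ * (y * e))) ≡ x * (y * (x + - 1ℚ * y)) * e
    lemma = solve-∀ ring

  ≢0-* : ∀ {p q} → p ≢ 0ℚ → q ≢ 0ℚ → p * q ≢ 0ℚ
  ≢0-* p≢0 q≢0 pq≡0 = q≢0 (*-≡0 p≢0 pq≡0)

  0<⇒≢0 : ∀ {x} → 0ℚ < x → x ≢ 0ℚ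
  0<⇒≢0 0<x x≡0 = <-irrefl (sym x≡0) 0<x

  0<1 : 0ℚ < 1ℚ
  0<1 = x<x+1 0ℚ

  Δ[x,1]≢0 : ∀ {x} → 1ℚ < x → Δ x 1ℚ ≢ 0ℚ
  Δ[x,1]≢0 {x} 1<x = ≢0-* {x} (0<⇒≢0 (<-trans 0<1 1<x)) (≢0-* {1ℚ} (λ ()) (<⇒-≢0 1<x))

  -- Δ takes the same value - x y (x + y) at the three points of the shuffle relation.
  Δ-lines : ∀ (F G : ℚ → ℚ → ℚ) x y → (∀ a b → F a b ≡ Δ a b * G a b) →
      (F x (x + y) + F y (x + y) ≡ - (x * (y * (x + y))) * (G x (x + y) + G y (x + y)))
    × (- 1ℚ * F x (- y) ≡ - (x * (y * (x + y))) * (- 1ℚ * G x (- y)))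
    × F (- y) (- x) ≡ Δ x y * G (- y) (- x)
  Δ-lines F G x y F≡ΔG =
    trans (cong₂ _+_ (F≡ΔG x (x + y)) (F≡ΔG y (x + y))) (lemma₁ x y (G x (x + y)) (G y (x + y))) ,
    trans (cong (- 1ℚ *_) (F≡ΔG x (- y))) (lemma₂ x y (G x (- y))) ,
    trans (F≡ΔG (- y) (- x)) (lemma₃ x y (G (- y) (- x)))
    where
    lemma₁ : ∀ x y g h →
      x * ((x + y) * (x + - 1ℚ * (x + y))) * g + y * ((x + y) * (y + - 1ℚ * (x + y))) * h
      ≡ - (x * (y * (x + y))) * (g + h)
    lemma₁ = solve-∀ ring
    lemma₂ : ∀ x y g → - 1ℚ * (x * (- y * (x + - 1ℚ * (- y))) * g) ≡ - (x * (y * (x + y))) * (- 1ℚ * g)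
    lemma₂ = solve-∀ ring
    lemma₃ : ∀ x y g → - y * (- x * (- y + - 1ℚ * (- x))) * g ≡ x * (y * (x + - 1ℚ * y)) * g
    lemma₃ = solve-∀ ring

  mulΔ-InLSh : ∀ {w} (R : V w) → InLSh w R → InLSh (3 ℕ.+ w) (mulΔ R)
  mulΔ-InLSh R R∈LSh = LShAt⇒InLSh (mulΔ R) 0ℚ (λ x _ →
    let lines = Δ-lines (ev (mulΔ R)) (ev R) x 1ℚ (ev-mulΔ R)
        at    = InLSh⇒LShAt R R∈LSh x 1ℚ
    in trans (proj₁ lines) (trans (cong (- (x * (1ℚ * (x + 1ℚ))) *_) (proj₁ at)) (sym (proj₁ (proj₂ lines)))) ,
       trans (ev-mulΔ R x 1ℚ) (trans (cong (Δ x 1ℚ *_) (proj₂ at)) (sym (proj₂ (proj₂ lines)))))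

  -- At (x , 1) with x > 1 neither Δ(x , 1) nor the common factor - x (x + 1) of the shuffle
  -- relation is zero, so both can be cancelled. This is the reason for the bound 1.
  quotient-InLSh : ∀ {w} (P : V (3 ℕ.+ w)) (R : V w) → InLSh (3 ℕ.+ w) P →
    (∀ x y → ev P x y ≡ Δ x y * ev R x y) → InLSh w R
  quotient-InLSh P R P∈LSh P≡ΔR = LShAt⇒InLSh R 1ℚ (λ x 1<x →
    let lines = Δ-lines (ev P) (ev R) x 1ℚ P≡ΔR
        at    = InLSh⇒LShAt P P∈LSh x 1ℚ
    in *-cancel-≢0 {q = ev R x (x + 1ℚ) + ev R 1ℚ (x + 1ℚ)} {r = - 1ℚ * ev R x (- 1ℚ)} (factor≢0 x 1<x)
         (trans (sym (proj₁ lines)) (trans (proj₁ at) (proj₁ (proj₂ lines)))) ,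
       *-cancel-≢0 {q = ev R x 1ℚ} {r = ev R (- 1ℚ) (- x)} (Δ[x,1]≢0 1<x)
         (trans (sym (P≡ΔR x 1ℚ)) (trans (proj₂ at) (proj₂ (proj₂ lines)))))
    where
    factor≢0 : ∀ x → 1ℚ < x → - (x * (1ℚ * (x + 1ℚ))) ≢ 0ℚ
    factor≢0 x 1<x eq = ≢0-* {x} (0<⇒≢0 0<x) (≢0-* {1ℚ} (λ ()) (0<⇒≢0 (<-trans 0<x (x<x+1 x))))
      (trans (sym (-‿involutive _)) (cong -_ eq))
      where
      0<x : 0ℚ < x
      0<x = <-trans 0<1 1<x

  module _ {n} (P : V (suc n)) (P∈LSh : InLSh (suc n) P) (P₀≡0 : P fzero ≡ 0ℚ) where

    private
      P[0,y] : ∀ y → ev P 0ℚ y ≡ 0ℚ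
      P[0,y] y = trans (ev-factor-X P P₀≡0 0ℚ y) (*-zeroˡ (ev (P ∘ fsuc) 0ℚ y))

      tail[1,y] : ∀ y → ev P 1ℚ y ≡ 0ℚ → ev (P ∘ fsuc) 1ℚ y ≡ 0ℚ
      tail[1,y] y eq = trans (sym (*-identityˡ (ev (P ∘ fsuc) 1ℚ y))) (trans (sym (ev-factor-X P P₀≡0 1ℚ y)) eq)

    -- The symmetry of LSh takes (0 , - 1) to (1 , 0), and P vanishes on the line X = 0. At X = 1
    -- the tail has the same value as P.
    tail[1,0]≡0 : ev (P ∘ fsuc) 1ℚ 0ℚ ≡ 0ℚ
    tail[1,0]≡0 = tail[1,y] 0ℚ (trans (sym (proj₂ (InLSh⇒LShAt P P∈LSh 0ℚ (- 1ℚ)))) (P[0,y] (- 1ℚ)))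

    -- In the shuffle relation at (0 , 1) the two terms other than P(1 , 1) are values on the line X
    -- = 0.
    tail[1,1]≡0 : ev (P ∘ fsuc) 1ℚ 1ℚ ≡ 0ℚ
    tail[1,1]≡0 = tail[1,y] 1ℚ (begin
      ev P 1ℚ 1ℚ                        ≡⟨ sym (+-identityˡ (ev P 1ℚ 1ℚ)) ⟩
      0ℚ + ev P 1ℚ 1ℚ                   ≡⟨ cong (_+ ev P 1ℚ 1ℚ) (sym (P[0,y] 1ℚ)) ⟩
      ev P 0ℚ 1ℚ + ev P 1ℚ 1ℚ           ≡⟨ proj₁ (InLSh⇒LShAt P P∈LSh 0ℚ 1ℚ) ⟩
      - 1ℚ * ev P 0ℚ (- 1ℚ)             ≡⟨ cong (- 1ℚ *_) (P[0,y] (- 1ℚ)) ⟩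
      - 1ℚ * 0ℚ                         ≡⟨ *-zeroʳ (- 1ℚ) ⟩
      0ℚ                                ∎)

  module _ {n} (P : V (suc (suc n))) (P∈LSh : InLSh (suc (suc n)) P) (P₀≡0 : P fzero ≡ 0ℚ) where

    reduced : V n
    reduced = quotient 1ℚ (P ∘ fsuc)

    ev-reduced : ∀ x y → ev P x y ≡ x * ((x - 1ℚ * y) * ev reduced x y)
    ev-reduced x y = trans (ev-factor-X P P₀≡0 x y)
      (cong (x *_) (ev-root 1ℚ (P ∘ fsuc) (tail[1,1]≡0 P P∈LSh P₀≡0) x y))

    reduced[1,0]≡0 : ev reduced 1ℚ 0ℚ ≡ 0ℚ
    reduced[1,0]≡0 = trans (sym (*-identityˡ (ev reduced 1ℚ 0ℚ))) (trans
      (sym (ev-root 1ℚ (P ∘ fsuc) (tail[1,1]≡0 P P∈LSh P₀≡0) 1ℚ 0ℚ))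
      (tail[1,0]≡0 P P∈LSh P₀≡0))

  divisible-by-Δ : ∀ {w} (P : V (3 ℕ.+ w)) → InLSh (3 ℕ.+ w) P → P fzero ≡ 0ℚ →
    Σ (V w) λ R → ∀ x y → ev P x y ≡ Δ x y * ev R x y
  divisible-by-Δ {w} P P∈LSh P₀≡0 = R , λ x y → begin
    ev P x y
      ≡⟨ ev-reduced P P∈LSh P₀≡0 x y ⟩
    x * ((x - 1ℚ * y) * ev P₂ x y)
      -- The zero at (1 , 0) means divisibility by Y. After the swap `ε` it becomes a zero at (0 ,
      -- 1), that is, a vanishing lowest coefficient, and a factor X splits off.
      ≡⟨ cong (λ e → x * ((x - 1ℚ * y) * e)) (trans (sym (ev-ε P₂ y x)) (trans
           (ev-factor-X P₃ (trans (sym (ev[0,1] P₃)) (trans (ev-ε P₂ 0ℚ 1ℚ) (reduced[1,0]≡0 P P∈LSh P₀≡0))) y x)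
           (cong (y *_) (sym (ev-ε (P₃ ∘ fsuc) x y))))) ⟩
    x * ((x - 1ℚ * y) * (y * ev R x y))
      ≡⟨ lemma x y (ev R x y) ⟩
    Δ x y * ev R x y ∎
    where
    P₂ P₃ : V (suc w)
    P₂ = reduced P P∈LSh P₀≡0
    P₃ = P₂ ∣ ε
    R : V w
    R = (P₃ ∘ fsuc) ∣ ε
    lemma : ∀ x y e → x * ((x - 1ℚ * y) * (y * e)) ≡ x * (y * (x + - 1ℚ * y)) * e
    lemma = solve-∀ ring

  hasDim-0 : ∀ {w} (U : V w → Set) → (∀ P → U P → P ≈ zeroV) → HasDim U 0
  hasDim-0 U U⊆0 = (λ ()) , (λ ()) , (λ _ _ ()) , λ P P∈U → (λ ()) , λ k → sym (U⊆0 P P∈U k)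

  IsSubspace : ∀ {w} → (V w → Set) → Set
  IsSubspace {w} U = ∀ (P Q : V w) c → U P → U Q → U (P ⊕ (c ⊛ Q))

  -- Rank and nullity for the functional `P fzero`: subtracting (P₀ / B₀) B moves any P of U into
  -- the kernel, and the lowest coefficient of a linear combination isolates the coefficient of B.
  hasDim-suc : ∀ {w n} (U : V w → Set) → IsSubspace U → (B : V w) → U B → B fzero ≢ 0ℚ →
    HasDim (λ P → U P × P fzero ≡ 0ℚ) n → HasDim U (suc n)
  hasDim-suc {w} {n} U subspace B B∈U B₀≢0 (b , b∈K , independent , spanning) =
    B ∷ b , (λ { fzero → B∈U ; (fsuc i) → proj₁ (b∈K i) }) , independent′ , spanning′
    where
    instance _ = ≢-nonZero B₀≢0

    independent′ : ∀ (c : Fin (suc n) → ℚ) → lincomb c (B ∷ b) ≈ zeroV → ∀ i → c i ≡ 0ℚ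
    independent′ c eq = λ { fzero → c₀≡0 ; (fsuc i) → independent (c ∘ fsuc) tail≡0 i }
      where
      tail₀≡0 : lincomb (c ∘ fsuc) b fzero ≡ 0ℚ
      tail₀≡0 = trans
        (sumFin-cong n (λ i → trans (cong (c (fsuc i) *_) (proj₂ (b∈K i))) (*-zeroʳ (c (fsuc i)))))
        (sumFin-0 n)
      c₀≡0 : c fzero ≡ 0ℚ
      c₀≡0 = *-≡0 B₀≢0 (begin
        B fzero * c fzero                                    ≡⟨ *-comm (B fzero) (c fzero) ⟩
        c fzero * B fzero                                    ≡⟨ sym (+-identityʳ (c fzero * B fzero)) ⟩
        c fzero * B fzero + 0ℚ                               ≡⟨ cong (c fzero * B fzero +_) (sym tail₀≡0) ⟩
        c fzero * B fzero + lincomb (c ∘ fsuc) b fzero       ≡⟨ eq fzero ⟩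
        0ℚ                                                   ∎)
      tail≡0 : lincomb (c ∘ fsuc) b ≈ zeroV
      tail≡0 k = begin
        lincomb (c ∘ fsuc) b k                    ≡⟨ lemma (B k) (lincomb (c ∘ fsuc) b k) ⟩
        0ℚ * B k + lincomb (c ∘ fsuc) b k         ≡⟨ cong (λ u → u * B k + lincomb (c ∘ fsuc) b k) (sym c₀≡0) ⟩
        c fzero * B k + lincomb (c ∘ fsuc) b k    ≡⟨ eq k ⟩
        0ℚ                                        ∎
        where
        lemma : ∀ p q → q ≡ 0ℚ * p + q
        lemma = solve-∀ ring

    spanning′ : ∀ P → U P → Σ (Fin (suc n) → ℚ) λ c → lincomb c (B ∷ b) ≈ P
    spanning′ P P∈U = c₀ ∷ proj₁ rest , λ k → trans (cong (c₀ * B k +_) (proj₂ rest k)) (lemma c₀ (B k) (P k))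
      where
      c₀ : ℚ
      c₀ = P fzero * 1/ B fzero
      P′ : V w
      P′ = P ⊕ ((- c₀) ⊛ B)
      P′₀≡0 : P′ fzero ≡ 0ℚ
      P′₀≡0 = trans (lemma₁ (P fzero) (1/ B fzero) (B fzero)) (trans
        (cong (λ u → P fzero + - (P fzero * u)) (*-inverseˡ (B fzero))) (lemma₂ (P fzero)))
        where
        lemma₁ : ∀ p u b → p + - (p * u) * b ≡ p + - (p * (u * b))
        lemma₁ = solve-∀ ring
        lemma₂ : ∀ p → p + - (p * 1ℚ) ≡ 0ℚ
        lemma₂ = solve-∀ ring
      rest : Σ (Fin n → ℚ) λ c → lincomb c b ≈ P′
      rest = spanning P′ (subspace P B (- c₀) P∈U B∈U , P′₀≡0)
      lemma : ∀ c b p → c * b + (p + - c * b) ≡ p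
      lemma = solve-∀ ring

  LSh-isSubspace : ∀ {w} → IsSubspace (InLSh w)
  LSh-isSubspace {w} P Q c P∈LSh Q∈LSh = LShAt⇒InLSh (P ⊕ (c ⊛ Q)) 0ℚ (λ x _ →
    let p = InLSh⇒LShAt P P∈LSh x 1ℚ
        q = InLSh⇒LShAt Q Q∈LSh x 1ℚ
    in (begin
         F x (x + 1ℚ) + F 1ℚ (x + 1ℚ)
           ≡⟨ cong₂ _+_ (ev-F x (x + 1ℚ)) (ev-F 1ℚ (x + 1ℚ)) ⟩
         (ev P x (x + 1ℚ) + c * ev Q x (x + 1ℚ)) + (ev P 1ℚ (x + 1ℚ) + c * ev Q 1ℚ (x + 1ℚ))
           ≡⟨ lemma₁ (ev P x (x + 1ℚ)) (ev Q x (x + 1ℚ)) (ev P 1ℚ (x + 1ℚ)) (ev Q 1ℚ (x + 1ℚ)) c ⟩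
         (ev P x (x + 1ℚ) + ev P 1ℚ (x + 1ℚ)) + c * (ev Q x (x + 1ℚ) + ev Q 1ℚ (x + 1ℚ))
           ≡⟨ cong₂ (λ u v → u + c * v) (proj₁ p) (proj₁ q) ⟩
         - 1ℚ * ev P x (- 1ℚ) + c * (- 1ℚ * ev Q x (- 1ℚ))
           ≡⟨ lemma₂ (ev P x (- 1ℚ)) (ev Q x (- 1ℚ)) c ⟩
         - 1ℚ * (ev P x (- 1ℚ) + c * ev Q x (- 1ℚ))
           ≡⟨ cong (- 1ℚ *_) (sym (ev-F x (- 1ℚ))) ⟩
         - 1ℚ * F x (- 1ℚ) ∎) ,
       trans (ev-F x 1ℚ) (trans (cong₂ (λ u v → u + c * v) (proj₂ p) (proj₂ q)) (sym (ev-F (- 1ℚ) (- x)))))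
    where
    F : ℚ → ℚ → ℚ
    F = ev (P ⊕ (c ⊛ Q))
    ev-F : ∀ x y → F x y ≡ ev P x y + c * ev Q x y
    ev-F x y = trans (ev-⊕ P (c ⊛ Q) x y) (cong (ev P x y +_) (ev-⊛ c Q x y))
    lemma₁ : ∀ p q r s c → (p + c * q) + (r + c * s) ≡ (p + r) + c * (q + s)
    lemma₁ = solve-∀ ring
    lemma₂ : ∀ p q c → - 1ℚ * p + c * (- 1ℚ * q) ≡ - 1ℚ * (p + c * q)
    lemma₂ = solve-∀ ring

  -- Multiplication by `Δ` carries a basis to a basis: independence survives because Δ(x , 1) is
  -- nonzero for x > 1, and spanning is the divisibility by `Δ` together with the membership of the
  -- quotient in LSh.
  hasDim-Δ : ∀ {w n} → HasDim (InLSh w) n → HasDim (λ P → InLSh (3 ℕ.+ w) P × P fzero ≡ 0ℚ) n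
  hasDim-Δ {w} {n} (b , b∈LSh , independent , spanning) =
    mulΔ ∘ b , (λ i → mulΔ-InLSh (b i) (b∈LSh i) , refl) , independent′ , spanning′
    where
    ev-lincomb-Δ : ∀ c x y → ev (lincomb c (mulΔ ∘ b)) x y ≡ Δ x y * ev (lincomb c b) x y
    ev-lincomb-Δ c x y = begin
      ev (lincomb c (mulΔ ∘ b)) x y
        ≡⟨ ev-lincomb c (mulΔ ∘ b) x y ⟩
      sumFin n (λ i → c i * ev (mulΔ (b i)) x y)
        ≡⟨ sumFin-cong n (λ i → trans (cong (c i *_) (ev-mulΔ (b i) x y)) (lemma (c i) (Δ x y) (ev (b i) x y))) ⟩
      sumFin n (λ i → Δ x y * (c i * ev (b i) x y))
        ≡⟨ sumFin-*ˡ n (Δ x y) (λ i → c i * ev (b i) x y) ⟩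
      Δ x y * sumFin n (λ i → c i * ev (b i) x y)
        ≡⟨ cong (Δ x y *_) (sym (ev-lincomb c b x y)) ⟩
      Δ x y * ev (lincomb c b) x y ∎
      where
      lemma : ∀ c d e → c * (d * e) ≡ d * (c * e)
      lemma = solve-∀ ring

    independent′ : ∀ (c : Fin n → ℚ) → lincomb c (mulΔ ∘ b) ≈ zeroV → ∀ i → c i ≡ 0ℚ
    independent′ c eq = independent c (ev-vanishing w (lincomb c b) 1ℚ (λ x 1<x →
      *-≡0 (Δ[x,1]≢0 1<x) (trans (sym (ev-lincomb-Δ c x 1ℚ))
        (trans (ev-cong eq x 1ℚ) (ev-zeroV {3 ℕ.+ w} x 1ℚ)))))

    spanning′ : ∀ P → InLSh (3 ℕ.+ w) P × P fzero ≡ 0ℚ → Σ (Fin n → ℚ) λ c → lincomb c (mulΔ ∘ b) ≈ P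
    spanning′ P (P∈LSh , P₀≡0) =
      let (R , P≡ΔR) = divisible-by-Δ P P∈LSh P₀≡0
          (c , c≈R)  = spanning R (quotient-InLSh P R P∈LSh P≡ΔR)
      in c , ev-injective (lincomb c (mulΔ ∘ b)) P 0ℚ (λ x _ →
           trans (ev-lincomb-Δ c x 1ℚ) (trans (cong (Δ x 1ℚ *_) (ev-cong c≈R x 1ℚ)) (sym (P≡ΔR x 1ℚ))))

  powerY : ∀ n → V n
  powerY n fzero    = 1ℚ
  powerY n (fsuc _) = 0ℚ

  ev-powerY : ∀ n x y → ev (powerY n) x y ≡ y ^ n
  ev-powerY zero    x y = ev-const (powerY 0) x y
  ev-powerY (suc n) x y = trans (ev-horner (powerY (suc n)) x y) (trans
    (cong (λ e → 1ℚ * y ^ suc n + x * e) (ev-zeroV {n} x y)) (lemma (y ^ suc n) x))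
    where
    lemma : ∀ p x → 1ℚ * p + x * 0ℚ ≡ p
    lemma = solve-∀ ring

  abstract

    -- Xⁿ + (-Y)ⁿ - 2 (Y - X)ⁿ
    leading : ∀ n → V n
    leading n = (powerY n ∣ mat (ℤ.+ 0) (ℤ.+ 0) (ℤ.+ 1) (ℤ.+ 0))
      ⊕ ((powerY n ∣ mat (ℤ.+ 0) (ℤ.+ 0) (ℤ.+ 0) (ℤ.- (ℤ.+ 1)))
      ⊕ ((- (1ℚ + 1ℚ)) ⊛ (powerY n ∣ mat (ℤ.+ 0) (ℤ.+ 0) (ℤ.- (ℤ.+ 1)) (ℤ.+ 1))))

    ev-leading : ∀ n x y → ev (leading n) x y ≡ x ^ n + ((- y) ^ n + - (1ℚ + 1ℚ) * (y - x) ^ n)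
    ev-leading n x y = trans (ev-⊕ A₁ (A₂ ⊕ ((- (1ℚ + 1ℚ)) ⊛ A₃)) x y) (cong₂ _+_
      (power _ _ (form₁₀ x y)) (trans (ev-⊕ A₂ ((- (1ℚ + 1ℚ)) ⊛ A₃) x y) (cong₂ _+_
      (power _ _ (form₀₋ x y)) (trans (ev-⊛ (- (1ℚ + 1ℚ)) A₃ x y) (cong (- (1ℚ + 1ℚ) *_)
      (power _ _ (form₋₁ x y)))))))
      where
      A₁ A₂ A₃ : V n
      A₁ = powerY n ∣ mat (ℤ.+ 0) (ℤ.+ 0) (ℤ.+ 1) (ℤ.+ 0)
      A₂ = powerY n ∣ mat (ℤ.+ 0) (ℤ.+ 0) (ℤ.+ 0) (ℤ.- (ℤ.+ 1))
      A₃ = powerY n ∣ mat (ℤ.+ 0) (ℤ.+ 0) (ℤ.- (ℤ.+ 1)) (ℤ.+ 1)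
      power : ∀ c d {q} → ℤ→ℚ c * x + ℤ→ℚ d * y ≡ q → ev (powerY n ∣ mat (ℤ.+ 0) (ℤ.+ 0) c d) x y ≡ q ^ n
      power c d {q} eq = trans (ev-∣-at (powerY n) (ℤ.+ 0) (ℤ.+ 0) c d x y refl eq)
        (ev-powerY n (0ℚ * x + 0ℚ * y) q)

  -- In the coordinates of G the form is xⁿ + yⁿ - 2 zⁿ with z = - x - y. It is symmetric in x and
  -- y, and in its cyclic sum every power occurs with coefficient 1 + 1 - 2 = 0; this dictates the
  -- constant 2.
  leading-InLSh : ∀ n → InLSh n (leading n)
  leading-InLSh n = LShAt⇒InLSh (leading n) 0ℚ (λ x _ → shuffle x 1ℚ , symmetric x 1ℚ)
    where
    2ℚ : ℚ
    2ℚ = 1ℚ + 1ℚ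
    F : ℚ → ℚ → ℚ
    F = ev (leading n)
    [x+y]-x : ∀ x y → (x + y) - x ≡ y
    [x+y]-x = solve-∀ ring
    [x+y]-y : ∀ x y → (x + y) - y ≡ x
    [x+y]-y = solve-∀ ring
    -y-x : ∀ x y → - y - x ≡ - (x + y)
    -y-x = solve-∀ ring
    -x--y : ∀ x y → - x - - y ≡ y - x
    -x--y = solve-∀ ring
    shuffle : ∀ x y → F x (x + y) + F y (x + y) ≡ - 1ℚ * F x (- y)
    shuffle x y = begin
      F x (x + y) + F y (x + y)
        ≡⟨ cong₂ _+_
             (trans (ev-leading n x (x + y)) (cong (λ u → x ^ n + (s + - 2ℚ * u ^ n)) ([x+y]-x x y)))
             (trans (ev-leading n y (x + y)) (cong (λ u → y ^ n + (s + - 2ℚ * u ^ n)) ([x+y]-y x y))) ⟩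
      (x ^ n + (s + - 2ℚ * y ^ n)) + (y ^ n + (s + - 2ℚ * x ^ n))
        ≡⟨ lemma (x ^ n) (y ^ n) s ⟩
      - 1ℚ * (x ^ n + (y ^ n + - 2ℚ * s))
        ≡⟨ cong (- 1ℚ *_) (sym (trans (ev-leading n x (- y))
             (cong₂ (λ u v → x ^ n + (u ^ n + - 2ℚ * v ^ n)) (-‿involutive y) (-y-x x y)))) ⟩
      - 1ℚ * F x (- y) ∎
      where
      s : ℚ
      s = (- (x + y)) ^ n
      lemma : ∀ p q s → (p + (s + - (1ℚ + 1ℚ) * q)) + (q + (s + - (1ℚ + 1ℚ) * p)) ≡ - 1ℚ * (p + (q + - (1ℚ + 1ℚ) * s))
      lemma = solve-∀ ring
    symmetric : ∀ x y → F x y ≡ F (- y) (- x)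
    symmetric x y = begin
      F x y
        ≡⟨ ev-leading n x y ⟩
      x ^ n + ((- y) ^ n + - 2ℚ * (y - x) ^ n)
        ≡⟨ lemma (x ^ n) ((- y) ^ n) (- 2ℚ * (y - x) ^ n) ⟩
      (- y) ^ n + (x ^ n + - 2ℚ * (y - x) ^ n)
        ≡⟨ sym (trans (ev-leading n (- y) (- x))
             (cong₂ (λ u v → (- y) ^ n + (u ^ n + - 2ℚ * v ^ n)) (-‿involutive x) (-x--y x y))) ⟩
      F (- y) (- x) ∎
      where
      lemma : ∀ p q r → p + (q + r) ≡ q + (p + r)
      lemma = solve-∀ ring

  -1^n≡±1 : ∀ n → (- 1ℚ) ^ n ≡ 1ℚ ⊎ (- 1ℚ) ^ n ≡ - 1ℚ
  -1^n≡±1 zero    = inj₁ refl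
  -1^n≡±1 (suc n) with -1^n≡±1 n
  ... | inj₁ eq = inj₂ (cong (- 1ℚ *_) eq)
  ... | inj₂ eq = inj₁ (cong (- 1ℚ *_) eq)

  -- The value at (0 , 1) is (- 1)ⁿ⁺¹ - 2, which is - 1 or - 3. The positive degree matters: in
  -- degree 0 the term from Xⁿ would add 1 and the value would be 1 + 1 - 2 = 0.
  leading₀≢0 : ∀ n → leading (suc n) fzero ≢ 0ℚ
  leading₀≢0 n eq = absurd (-1^n≡±1 (suc n))
    where
    value : ∀ s → (- 1ℚ) ^ suc n ≡ s → 0ℚ ≡ 0ℚ + (s + - (1ℚ + 1ℚ) * 1ℚ)
    value s s≡ = begin
      0ℚ                            ≡⟨ sym eq ⟩
      leading (suc n) fzero         ≡⟨ sym (ev[0,1] (leading (suc n))) ⟩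
      ev (leading (suc n)) 0ℚ 1ℚ    ≡⟨ ev-leading (suc n) 0ℚ 1ℚ ⟩
      0ℚ ^ suc n + ((- 1ℚ) ^ suc n + - (1ℚ + 1ℚ) * 1ℚ ^ suc n)
        ≡⟨ cong₂ _+_ (*-zeroˡ (0ℚ ^ n)) (cong₂ (λ u v → u + - (1ℚ + 1ℚ) * v) s≡ (1^n≡1 (suc n))) ⟩
      0ℚ + (s + - (1ℚ + 1ℚ) * 1ℚ)   ∎
    absurd : ¬ ((- 1ℚ) ^ suc n ≡ 1ℚ ⊎ (- 1ℚ) ^ suc n ≡ - 1ℚ)
    absurd (inj₁ s≡1)  = contradiction (value 1ℚ s≡1) (λ ())
    absurd (inj₂ s≡-1) = contradiction (value (- 1ℚ) s≡-1) (λ ())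

  LSh₀≡0 : ∀ P → InLSh 0 P → P ≈ zeroV
  LSh₀≡0 P P∈LSh fzero = *-≡0 {1ℚ + 1ℚ + 1ℚ} (λ ()) (begin
    (1ℚ + 1ℚ + 1ℚ) * p          ≡⟨ lemma p ⟩
    (p + p) - (- 1ℚ * p)        ≡⟨ cong (_- (- 1ℚ * p)) relation ⟩
    - 1ℚ * p - (- 1ℚ * p)       ≡⟨ +-inverseʳ (- 1ℚ * p) ⟩
    0ℚ                          ∎)
    where
    p : ℚ
    p = P fzero
    lemma : ∀ p → (1ℚ + 1ℚ + 1ℚ) * p ≡ (p + p) - (- 1ℚ * p)
    lemma = solve-∀ ring
    relation : p + p ≡ - 1ℚ * p
    relation = trans (sym (cong₂ _+_ (ev-const P 0ℚ 0ℚ) (ev-const P 0ℚ 0ℚ)))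
      (trans (proj₁ (InLSh⇒LShAt P P∈LSh 0ℚ 0ℚ)) (cong (- 1ℚ *_) (ev-const P 0ℚ 0ℚ)))

  LSh₁-kernel : ∀ P → InLSh 1 P × P fzero ≡ 0ℚ → P ≈ zeroV
  LSh₁-kernel P (P∈LSh , P₀≡0) fzero        = P₀≡0
  LSh₁-kernel P (P∈LSh , P₀≡0) (fsuc fzero) =
    trans (sym (ev-const (P ∘ fsuc) 1ℚ 0ℚ)) (tail[1,0]≡0 P P∈LSh P₀≡0)

  -- A form of degree 2 cannot have the three distinct zeros (0 , 1), (1 , 1) and (1 , 0): after two
  -- linear factors only a constant is left, and the third zero annihilates it.
  LSh₂-kernel : ∀ P → InLSh 2 P × P fzero ≡ 0ℚ → P ≈ zeroV
  LSh₂-kernel P (P∈LSh , P₀≡0) = ev-vanishing 2 P 0ℚ (λ x _ → begin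
    ev P x 1ℚ
      ≡⟨ ev-reduced P P∈LSh P₀≡0 x 1ℚ ⟩
    x * ((x - 1ℚ * 1ℚ) * ev R x 1ℚ)
      ≡⟨ cong (λ e → x * ((x - 1ℚ * 1ℚ) * e)) (trans (ev-const R x 1ℚ)
           (trans (sym (ev-const R 1ℚ 0ℚ)) (reduced[1,0]≡0 P P∈LSh P₀≡0))) ⟩
    x * ((x - 1ℚ * 1ℚ) * 0ℚ)
      ≡⟨ lemma x (x - 1ℚ * 1ℚ) ⟩
    0ℚ ∎)
    where
    R : V 0
    R = reduced P P∈LSh P₀≡0
    lemma : ∀ x u → x * (u * 0ℚ) ≡ 0ℚ
    lemma = solve-∀ ring

  hasDim-LSh-suc : ∀ w {n} → HasDim (λ P → InLSh (suc w) P × P fzero ≡ 0ℚ) n → HasDim (InLSh (suc w)) (suc n)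
  hasDim-LSh-suc w = hasDim-suc (InLSh (suc w)) LSh-isSubspace (leading (suc w)) (leading-InLSh (suc w)) (leading₀≢0 w)

  -- Since `Δ` has degree 3, the recursion needs three base degrees, of dimensions 0, 1 and 1. Each
  -- step by 3 adds one dimension, spanned by `leading`, matching (w + 5) / 3 = 1 + (w + 2) / 3.
  hasDim-LSh : ∀ w → HasDim (InLSh w) ((w ℕ.+ 2) ℕ./ 3)
  hasDim-LSh 0 = hasDim-0 (InLSh 0) LSh₀≡0
  hasDim-LSh 1 = hasDim-LSh-suc 0 (hasDim-0 (λ P → InLSh 1 P × P fzero ≡ 0ℚ) LSh₁-kernel)
  hasDim-LSh 2 = hasDim-LSh-suc 1 (hasDim-0 (λ P → InLSh 2 P × P fzero ≡ 0ℚ) LSh₂-kernel)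
  hasDim-LSh (suc (suc (suc w))) =
    subst (HasDim (InLSh (3 ℕ.+ w))) (sym (m/n≡1+[m∸n]/n {3 ℕ.+ w ℕ.+ 2} {3} (s≤s (s≤s (s≤s z≤n)))))
      (hasDim-LSh-suc (2 ℕ.+ w) (hasDim-Δ (hasDim-LSh w)))

  -- The pairing

  -- Invariance under `≈` is a clause of its own because forms are functions compared
  -- coefficientwise.
  IsLinear : ∀ {w} → (V w → ℚ) → Set
  IsLinear {w} ψ =
      (∀ P Q → P ≈ Q → ψ P ≡ ψ Q)
    × (∀ P Q → ψ (P ⊕ Q) ≡ ψ P + ψ Q)
    × (∀ c P → ψ (c ⊛ P) ≡ c * ψ P)

  ev-isLinear : ∀ {w} x y → IsLinear {w} (λ P → ev P x y)
  ev-isLinear x y = (λ P Q P≈Q → ev-cong P≈Q x y) , (λ P Q → ev-⊕ P Q x y) , (λ c P → ev-⊛ c P x y)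

  module _ {w} {ψ : V w → ℚ} (ψ-linear : IsLinear ψ) where

    linear-zeroV : ψ zeroV ≡ 0ℚ
    linear-zeroV = trans (proj₁ ψ-linear zeroV (0ℚ ⊛ zeroV) (λ _ → refl))
      (trans (proj₂ (proj₂ ψ-linear) 0ℚ zeroV) (*-zeroˡ (ψ zeroV)))

    linear-lincomb : ∀ {n} (c : Fin n → ℚ) (b : Fin n → V w) →
      ψ (lincomb c b) ≡ sumFin n (λ i → c i * ψ (b i))
    linear-lincomb {zero}  c b = linear-zeroV
    linear-lincomb {suc n} c b = trans
      (proj₁ (proj₂ ψ-linear) (c fzero ⊛ b fzero) (lincomb (c ∘ fsuc) (b ∘ fsuc)))
      (cong₂ _+_ (proj₂ (proj₂ ψ-linear) (c fzero) (b fzero)) (linear-lincomb (c ∘ fsuc) (b ∘ fsuc)))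

  sumFin-kron : ∀ n (f : Fin n → ℚ) j → sumFin n (λ i → f i * kron (toℕ i) (toℕ j)) ≡ f j
  sumFin-kron (suc n) f fzero = trans
    (cong₂ _+_ (*-identityʳ (f fzero))
      (trans (sumFin-cong n (λ i → *-zeroʳ (f (fsuc i)))) (sumFin-0 n)))
    (+-identityʳ (f fzero))
  sumFin-kron (suc n) f (fsuc j) = trans
    (cong₂ _+_ (*-zeroʳ (f fzero)) (sumFin-kron n (f ∘ fsuc) j)) (+-identityˡ (f (fsuc j)))

  monomialV : ∀ {w} → Fin (suc w) → V w
  monomialV b i = kron (toℕ b) (toℕ i)

  linear-coefficients : ∀ {w} {ψ : V w → ℚ} → IsLinear ψ → ∀ Q →
    ψ Q ≡ sumFin (suc w) (λ b → Q b * ψ (monomialV b))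
  linear-coefficients {w} {ψ} ψ-linear Q = trans
    (proj₁ ψ-linear Q (lincomb Q monomialV) (λ i → sym (sumFin-kron (suc w) Q i)))
    (linear-lincomb ψ-linear Q monomialV)

  sumFin-last : ∀ n (f : Fin (suc n) → ℚ) → sumFin (suc n) f ≡ sumFin n (f ∘ inject₁) + f (fromℕ n)
  sumFin-last zero    f = +-comm (f fzero) 0ℚ
  sumFin-last (suc n) f = trans (cong (f fzero +_) (sumFin-last n (f ∘ fsuc)))
    (sym (+-assoc (f fzero) (sumFin n (f ∘ fsuc ∘ inject₁)) (f (fsuc (fromℕ n)))))

  sumFin-opposite : ∀ n (f : Fin n → ℚ) → sumFin n (f ∘ opposite) ≡ sumFin n f
  sumFin-opposite zero    f = refl
  sumFin-opposite (suc n) f = trans (cong (f (fromℕ n) +_) (sumFin-opposite n (f ∘ inject₁)))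
    (trans (+-comm (f (fromℕ n)) (sumFin n (f ∘ inject₁))) (sym (sumFin-last n f)))

  nCk>0 : ∀ {n k} → k ℕ.≤ n → 0 ℕ.< n C k
  nCk>0 {n}     {zero}  _         = s≤s z≤n
  nCk>0 {suc n} {suc k} (s≤s k≤n) =
    subst (0 ℕ.<_) (nCk+nC[k+1]≡[n+1]C[k+1] n k) (ℕₚ.<-≤-trans (nCk>0 k≤n) (ℕₚ.m≤m+n (n C k) (n C suc k)))

  ℕ→ℚ*invℕ : ∀ n → 0 ℕ.< n → ℕ→ℚ n * invℕ n ≡ 1ℚ
  ℕ→ℚ*invℕ (suc m) _ = toℚᵘ-injective
    (ℚᵘₚ.≃-trans (toℚᵘ-homo-* (ℕ→ℚ (suc m)) (invℕ (suc m)))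
      (ℚᵘₚ.≃-trans (ℚᵘₚ.*-cong (toℚᵘ-fromℚᵘ (mkℚᵘ (ℤ.+ suc m) 0)) (toℚᵘ-fromℚᵘ (mkℚᵘ (ℤ.+ 1) m)))
        (*≡* (trans (ℤₚ.*-identityʳ ((ℤ.+ suc m) ℤ.* (ℤ.+ 1))) (trans (ℤₚ.*-identityʳ (ℤ.+ suc m))
          (sym (trans (ℤₚ.*-identityˡ (ℤ.+ (1 ℕ.* suc m))) (cong ℤ.+_ (ℕₚ.*-identityˡ (suc m))))))))))

  sgn : ℕ → ℚ
  sgn a = ℤ→ℚ ((ℤ.- (ℤ.+ 1)) ℤ.^ suc a)

  sgn≡ : ∀ a → sgn a ≡ - 1ℚ * (- 1ℚ) ^ a
  sgn≡ a = ℤ→ℚ-^ (ℤ.- (ℤ.+ 1)) (suc a)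

  sgn*sgn : ∀ a → sgn a * sgn a ≡ 1ℚ
  sgn*sgn a = trans (cong₂ _*_ (sgn≡ a) (sgn≡ a))
    (trans (lemma ((- 1ℚ) ^ a)) (trans (sym (^-distrib-* (- 1ℚ) (- 1ℚ) a)) (1^n≡1 a)))
    where
    lemma : ∀ p → - 1ℚ * p * (- 1ℚ * p) ≡ p * p
    lemma = solve-∀ ring

  toℕ-opposite : ∀ {w} (b : Fin (suc w)) → toℕ (opposite b) ≡ w ∸ toℕ b
  toℕ-opposite b = opposite-prop b

  -- The value of the functional ⟨ P , _ ⟩ on XᵇYʷ⁻ᵇ: the Kronecker delta leaves only the index a =
  -- w - b.
  dual : ∀ {w} → V w → Fin (suc w) → ℚ
  dual {w} P b = P (opposite b) * sgn (toℕ (opposite b)) * invℕ (w C toℕ b)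

  pairing-dual : ∀ {w} (P Q : V w) → ⟨ P , Q ⟩ ≡ sumFin (suc w) (λ b → Q b * dual P b)
  pairing-dual {w} P Q = begin
    sumFin (suc w) (λ a → sumFin (suc w) (λ b → f b a * kron (toℕ a) (w ∸ toℕ b)))
      ≡⟨ sumFin-swap (suc w) (suc w) (λ a b → f b a * kron (toℕ a) (w ∸ toℕ b)) ⟩
    sumFin (suc w) (λ b → sumFin (suc w) (λ a → f b a * kron (toℕ a) (w ∸ toℕ b)))
      ≡⟨ sumFin-cong (suc w) (λ b → begin
           sumFin (suc w) (λ a → f b a * kron (toℕ a) (w ∸ toℕ b))
             ≡⟨ cong (λ m → sumFin (suc w) (λ a → f b a * kron (toℕ a) m)) (sym (toℕ-opposite b)) ⟩
           sumFin (suc w) (λ a → f b a * kron (toℕ a) (toℕ (opposite b)))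
             ≡⟨ sumFin-kron (suc w) (f b) (opposite b) ⟩
           f b (opposite b)
             ≡⟨ lemma (P (opposite b)) (Q b) (sgn (toℕ (opposite b))) (invℕ (w C toℕ b)) ⟩
           Q b * dual P b ∎) ⟩
    sumFin (suc w) (λ b → Q b * dual P b) ∎
    where
    f : Fin (suc w) → Fin (suc w) → ℚ
    f b a = P a * Q b * sgn (toℕ a) * invℕ (w C toℕ b)
    lemma : ∀ p q s i → p * q * s * i ≡ q * (p * s * i)
    lemma = solve-∀ ring

  pairing-congˡ : ∀ {w} (P P′ Q : V w) → P ≈ P′ → ⟨ P , Q ⟩ ≡ ⟨ P′ , Q ⟩
  pairing-congˡ {w} P P′ Q P≈P′ = trans (pairing-dual P Q) (trans
    (sumFin-cong (suc w) (λ b →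
      cong (λ p → Q b * (p * sgn (toℕ (opposite b)) * invℕ (w C toℕ b))) (P≈P′ (opposite b))))
    (sym (pairing-dual P′ Q)))

  pairing-⊕ˡ : ∀ {w} (P P′ Q : V w) → ⟨ P ⊕ P′ , Q ⟩ ≡ ⟨ P , Q ⟩ + ⟨ P′ , Q ⟩
  pairing-⊕ˡ {w} P P′ Q = begin
    ⟨ P ⊕ P′ , Q ⟩
      ≡⟨ pairing-dual (P ⊕ P′) Q ⟩
    sumFin (suc w) (λ b → Q b * dual (P ⊕ P′) b)
      ≡⟨ sumFin-cong (suc w) (λ b →
           lemma (Q b) (P (opposite b)) (P′ (opposite b)) (sgn (toℕ (opposite b))) (invℕ (w C toℕ b))) ⟩
    sumFin (suc w) (λ b → Q b * dual P b + Q b * dual P′ b)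
      ≡⟨ sumFin-+ (suc w) (λ b → Q b * dual P b) (λ b → Q b * dual P′ b) ⟩
    sumFin (suc w) (λ b → Q b * dual P b) + sumFin (suc w) (λ b → Q b * dual P′ b)
      ≡⟨ sym (cong₂ _+_ (pairing-dual P Q) (pairing-dual P′ Q)) ⟩
    ⟨ P , Q ⟩ + ⟨ P′ , Q ⟩ ∎
    where
    lemma : ∀ q p p′ s i → q * ((p + p′) * s * i) ≡ q * (p * s * i) + q * (p′ * s * i)
    lemma = solve-∀ ring

  pairing-⊛ˡ : ∀ {w} c (P Q : V w) → ⟨ c ⊛ P , Q ⟩ ≡ c * ⟨ P , Q ⟩
  pairing-⊛ˡ {w} c P Q = begin
    ⟨ c ⊛ P , Q ⟩
      ≡⟨ pairing-dual (c ⊛ P) Q ⟩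
    sumFin (suc w) (λ b → Q b * dual (c ⊛ P) b)
      ≡⟨ sumFin-cong (suc w) (λ b →
           lemma (Q b) c (P (opposite b)) (sgn (toℕ (opposite b))) (invℕ (w C toℕ b))) ⟩
    sumFin (suc w) (λ b → c * (Q b * dual P b))
      ≡⟨ sumFin-*ˡ (suc w) c (λ b → Q b * dual P b) ⟩
    c * sumFin (suc w) (λ b → Q b * dual P b)
      ≡⟨ cong (c *_) (sym (pairing-dual P Q)) ⟩
    c * ⟨ P , Q ⟩ ∎
    where
    lemma : ∀ q c p s i → q * (c * p * s * i) ≡ c * (q * (p * s * i))
    lemma = solve-∀ ring

  pair-⊕ : ∀ {w} (P P′ Q : V w) → pair (P ⊕ P′) Q ≡ pair P Q + pair P′ Q
  pair-⊕ P P′ Q = trans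
    (pairing-congˡ ((P ⊕ P′) ∣ δ) ((P ∣ δ) ⊕ (P′ ∣ δ)) Q
      (ev-injective ((P ⊕ P′) ∣ δ) ((P ∣ δ) ⊕ (P′ ∣ δ)) 0ℚ (λ x _ →
        trans (ev-δ (P ⊕ P′) x 1ℚ) (trans (ev-⊕ P P′ x (- 1ℚ)) (trans
          (sym (cong₂ _+_ (ev-δ P x 1ℚ) (ev-δ P′ x 1ℚ))) (sym (ev-⊕ (P ∣ δ) (P′ ∣ δ) x 1ℚ)))))))
    (pairing-⊕ˡ (P ∣ δ) (P′ ∣ δ) Q)

  pair-⊛ : ∀ {w} c (P Q : V w) → pair (c ⊛ P) Q ≡ c * pair P Q
  pair-⊛ c P Q = trans
    (pairing-congˡ ((c ⊛ P) ∣ δ) (c ⊛ (P ∣ δ)) Q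
      (ev-injective ((c ⊛ P) ∣ δ) (c ⊛ (P ∣ δ)) 0ℚ (λ x _ →
        trans (ev-δ (c ⊛ P) x 1ℚ) (trans (ev-⊛ c P x (- 1ℚ)) (trans
          (sym (cong (c *_) (ev-δ P x 1ℚ))) (sym (ev-⊛ c (P ∣ δ) x 1ℚ)))))))
    (pairing-⊛ˡ c (P ∣ δ) Q)

  pairing-isLinear : ∀ {w} (P : V w) → IsLinear ⟨ P ,_⟩
  pairing-isLinear {w} P =
    (λ Q Q′ Q≈Q′ → trans (pairing-dual P Q) (trans
      (sumFin-cong (suc w) (λ b → cong (_* dual P b) (Q≈Q′ b))) (sym (pairing-dual P Q′)))) ,
    (λ Q Q′ → trans (pairing-dual P (Q ⊕ Q′)) (trans
      (sumFin-cong (suc w) (λ b → *-distribʳ-+ (dual P b) (Q b) (Q′ b)))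
      (trans (sumFin-+ (suc w) (λ b → Q b * dual P b) (λ b → Q′ b * dual P b))
        (sym (cong₂ _+_ (pairing-dual P Q) (pairing-dual P Q′)))))) ,
    (λ c Q → trans (pairing-dual P (c ⊛ Q)) (trans
      (sumFin-cong (suc w) (λ b → *-assoc c (Q b) (dual P b)))
      (trans (sumFin-*ˡ (suc w) c (λ b → Q b * dual P b)) (cong (c *_) (sym (pairing-dual P Q))))))

  -- (uX + vY)ʷ
  linearPower : ∀ {w} → ℚ → ℚ → V w
  linearPower {w} u v i = ℕ→ℚ (w C toℕ i) * u ^ toℕ i * v ^ (w ∸ toℕ i)

  ev-linearPower : ∀ {w} u v x y → ev (linearPower {w} u v) x y ≡ (u * x + v * y) ^ w
  ev-linearPower {w} u v x y = sym (binomial-expansion w u v x y)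

  -- A reproducing property: the binomial coefficients of the power cancel the inverse ones in the
  -- pairing, and the sign (- 1)ᵃ⁺¹ turns vᵃ into - (- v)ᵃ.
  pairing-linearPower : ∀ {w} (P : V w) u v → ⟨ P , linearPower u v ⟩ ≡ - 1ℚ * ev P (- v) u
  pairing-linearPower {w} P u v = begin
    ⟨ P , linearPower u v ⟩
      ≡⟨ pairing-dual P (linearPower u v) ⟩
    sumFin (suc w) (λ b → linearPower {w} u v b * dual P b)
      ≡⟨ sumFin-cong (suc w) term ⟩
    sumFin (suc w) (g ∘ opposite)
      ≡⟨ sumFin-opposite (suc w) g ⟩
    sumFin (suc w) g
      ≡⟨ sumFin-*ˡ (suc w) (- 1ℚ) (λ a → P a * monomial w (- v) u (toℕ a)) ⟩
    - 1ℚ * ev P (- v) u ∎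
    where
    g : Fin (suc w) → ℚ
    g a = - 1ℚ * (P a * monomial w (- v) u (toℕ a))
    lemma₁ : ∀ c p q r s i → c * p * q * (r * s * i) ≡ (c * i) * (r * s * (q * p))
    lemma₁ = solve-∀ ring
    lemma₂ : ∀ r e q p → 1ℚ * (r * (- 1ℚ * e) * (q * p)) ≡ - 1ℚ * (r * ((e * q) * p))
    lemma₂ = solve-∀ ring
    -v^n : ∀ n → (- 1ℚ) ^ n * v ^ n ≡ (- v) ^ n
    -v^n n = trans (sym (^-distrib-* (- 1ℚ) v n)) (cong (_^ n) (lemma v))
      where
      lemma : ∀ v → - 1ℚ * v ≡ - v
      lemma = solve-∀ ring
    term : ∀ b → linearPower {w} u v b * dual P b ≡ g (opposite b)
    term b = begin
      ℕ→ℚ (w C toℕ b) * u ^ toℕ b * v ^ (w ∸ toℕ b) * dual P b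
        ≡⟨ cong₂ (λ m n → ℕ→ℚ (w C toℕ b) * u ^ m * v ^ n * dual P b)
             (trans (sym (ℕₚ.m∸[m∸n]≡n (toℕ≤pred[n] b))) (cong (w ∸_) (sym (toℕ-opposite b))))
             (sym (toℕ-opposite b)) ⟩
      ℕ→ℚ (w C toℕ b) * u ^ (w ∸ a) * v ^ a * (P (opposite b) * sgn a * invℕ (w C toℕ b))
        ≡⟨ lemma₁ (ℕ→ℚ (w C toℕ b)) (u ^ (w ∸ a)) (v ^ a) (P (opposite b)) (sgn a) (invℕ (w C toℕ b)) ⟩
      ℕ→ℚ (w C toℕ b) * invℕ (w C toℕ b) * (P (opposite b) * sgn a * (v ^ a * u ^ (w ∸ a)))
        ≡⟨ cong₂ (λ i s → i * (P (opposite b) * s * (v ^ a * u ^ (w ∸ a))))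
             (ℕ→ℚ*invℕ (w C toℕ b) (nCk>0 (toℕ≤pred[n] b))) (sgn≡ a) ⟩
      1ℚ * (P (opposite b) * (- 1ℚ * (- 1ℚ) ^ a) * (v ^ a * u ^ (w ∸ a)))
        ≡⟨ lemma₂ (P (opposite b)) ((- 1ℚ) ^ a) (v ^ a) (u ^ (w ∸ a)) ⟩
      - 1ℚ * (P (opposite b) * ((- 1ℚ) ^ a * v ^ a * u ^ (w ∸ a)))
        ≡⟨ cong (λ e → - 1ℚ * (P (opposite b) * (e * u ^ (w ∸ a)))) (-v^n a) ⟩
      g (opposite b) ∎
      where
      a : ℕ
      a = toℕ (opposite b)

  -- Obtained by solving for the coefficients of `dual`: the sign is its own inverse, and the
  -- nonzero binomial coefficient cancels the inverse one. This shows that every linear functional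
  -- on the whole space is given by the pairing.
  representative : ∀ {w} → (V w → ℚ) → V w
  representative {w} ψ a = ψ (monomialV (opposite a)) * sgn (toℕ a) * ℕ→ℚ (w C toℕ (opposite a))

  pairing-representative : ∀ {w} {ψ : V w → ℚ} → IsLinear ψ → ∀ Q → ⟨ representative ψ , Q ⟩ ≡ ψ Q
  pairing-representative {w} {ψ} ψ-linear Q = begin
    ⟨ representative ψ , Q ⟩
      ≡⟨ pairing-dual (representative ψ) Q ⟩
    sumFin (suc w) (λ b → Q b * dual (representative ψ) b)
      ≡⟨ sumFin-cong (suc w) (λ b → cong (Q b *_) (dual-representative b)) ⟩
    sumFin (suc w) (λ b → Q b * ψ (monomialV b))
      ≡⟨ sym (linear-coefficients ψ-linear Q) ⟩
    ψ Q ∎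
    where
    lemma : ∀ g s c i → g * s * c * s * i ≡ g * (s * s) * (c * i)
    lemma = solve-∀ ring
    dual-representative : ∀ b → dual (representative ψ) b ≡ ψ (monomialV b)
    dual-representative b = begin
      ψ (monomialV (opposite (opposite b))) * s * ℕ→ℚ (w C toℕ (opposite (opposite b))) * s * i
        ≡⟨ cong (λ j → ψ (monomialV j) * s * ℕ→ℚ (w C toℕ j) * s * i) (opposite-involutive b) ⟩
      ψ (monomialV b) * s * ℕ→ℚ (w C toℕ b) * s * i
        ≡⟨ lemma (ψ (monomialV b)) s (ℕ→ℚ (w C toℕ b)) i ⟩
      ψ (monomialV b) * (s * s) * (ℕ→ℚ (w C toℕ b) * i)
        ≡⟨ cong₂ (λ p q → ψ (monomialV b) * p * q) (sgn*sgn (toℕ (opposite b)))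
             (ℕ→ℚ*invℕ (w C toℕ b) (nCk>0 (toℕ≤pred[n] b))) ⟩
      ψ (monomialV b) * 1ℚ * 1ℚ
        ≡⟨ trans (*-identityʳ (ψ (monomialV b) * 1ℚ)) (*-identityʳ (ψ (monomialV b))) ⟩
      ψ (monomialV b) ∎
      where
      s i : ℚ
      s = sgn (toℕ (opposite b))
      i = invℕ (w C toℕ b)

  -- The projection onto W

  2ℚ ⅙ : ℚ
  2ℚ = 1ℚ + 1ℚ
  ⅙  = invℕ 6

  -- The expanded product of the idempotents 1 - (1 + γ′ + γ′²) / 3 and (1 + ε′) / 2, with arguments
  -- in the order 1, γ′, γ′², ε′, ρ, σ. The first idempotent is central, because conjugation by ε′
  -- exchanges γ′ and γ′²; hence the product is absorbed on either side.
  Π₆ : ℚ → ℚ → ℚ → ℚ → ℚ → ℚ → ℚ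
  Π₆ a b c d e f = ⅙ * (((2ℚ * a + - 1ℚ * b) + - 1ℚ * c) + ((2ℚ * d + - 1ℚ * e) + - 1ℚ * f))

  Π₆-cong : ∀ {a b c d e f a′ b′ c′ d′ e′ f′} →
    a ≡ a′ → b ≡ b′ → c ≡ c′ → d ≡ d′ → e ≡ e′ → f ≡ f′ → Π₆ a b c d e f ≡ Π₆ a′ b′ c′ d′ e′ f′
  Π₆-cong refl refl refl refl refl refl = refl

  module _ {w} (A B C′ D E F : V w) where

    combine₆ : V w
    combine₆ = ⅙ ⊛ ((((2ℚ ⊛ A) ⊕ ((- 1ℚ) ⊛ B)) ⊕ ((- 1ℚ) ⊛ C′)) ⊕ (((2ℚ ⊛ D) ⊕ ((- 1ℚ) ⊛ E)) ⊕ ((- 1ℚ) ⊛ F)))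

    linear-combine₆ : ∀ {ψ} → IsLinear ψ → ψ combine₆ ≡ Π₆ (ψ A) (ψ B) (ψ C′) (ψ D) (ψ E) (ψ F)
    linear-combine₆ {ψ} (_ , additive , homogeneous) = trans
      (homogeneous ⅙ (half A B C′ ⊕ half D E F))
      (cong (⅙ *_) (trans (additive (half A B C′) (half D E F)) (cong₂ _+_ (ψ-half A B C′) (ψ-half D E F))))
      where
      half : V w → V w → V w → V w
      half P Q R = ((2ℚ ⊛ P) ⊕ ((- 1ℚ) ⊛ Q)) ⊕ ((- 1ℚ) ⊛ R)
      ψ-half : ∀ P Q R → ψ (half P Q R) ≡ (2ℚ * ψ P + - 1ℚ * ψ Q) + - 1ℚ * ψ R
      ψ-half P Q R = trans (additive ((2ℚ ⊛ P) ⊕ ((- 1ℚ) ⊛ Q)) ((- 1ℚ) ⊛ R))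
        (cong₂ _+_ (trans (additive (2ℚ ⊛ P) ((- 1ℚ) ⊛ Q)) (cong₂ _+_ (homogeneous 2ℚ P) (homogeneous (- 1ℚ) Q)))
          (homogeneous (- 1ℚ) R))

  -- The dihedral group generated by ε′ and γ′ consists of 1, γ′, γ′², ε′, ρ and σ.
  ρ σ : Mat
  ρ = mat (ℤ.- (ℤ.+ 1)) (ℤ.+ 0) (ℤ.+ 1) (ℤ.+ 1)
  σ = mat (ℤ.+ 1) (ℤ.+ 1) (ℤ.+ 0) (ℤ.- (ℤ.+ 1))

  ev-ρ : ∀ {w} (P : V w) x y → ev (P ∣ ρ) x y ≡ ev P (- x) (x + y)
  ev-ρ P x y = ev-∣-at P _ _ _ _ x y (form₋₀ x y) (form₁₁ x y)

  ev-σ : ∀ {w} (P : V w) x y → ev (P ∣ σ) x y ≡ ev P (x + y) (- y)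
  ev-σ P x y = ev-∣-at P _ _ _ _ x y (form₁₁ x y) (form₀₋ x y)

  abstract

    project : ∀ {w} → V w → V w
    project Q = combine₆ Q (Q ∣ γ′) (Q ∣ (γ′ · γ′)) (Q ∣ ε′) (Q ∣ ρ) (Q ∣ σ)

    -- The functional is arbitrary because two kinds are needed: evaluation at a point, and the
    -- pairing with a fixed form.
    linear-project : ∀ {w} (Q : V w) {ψ : V w → ℚ} → IsLinear ψ →
      ψ (project Q) ≡ Π₆ (ψ Q) (ψ (Q ∣ γ′)) (ψ (Q ∣ (γ′ · γ′))) (ψ (Q ∣ ε′)) (ψ (Q ∣ ρ)) (ψ (Q ∣ σ))
    linear-project Q = linear-combine₆ Q (Q ∣ γ′) (Q ∣ (γ′ · γ′)) (Q ∣ ε′) (Q ∣ ρ) (Q ∣ σ)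

  Π : (ℚ → ℚ → ℚ) → ℚ → ℚ → ℚ
  Π F x y = Π₆ (F x y) (F y (- x - y)) (F (- x - y) x) (F (- y) (- x)) (F (- x) (x + y)) (F (x + y) (- y))

  ev-project : ∀ {w} (Q : V w) x y → ev (project Q) x y ≡ Π (ev Q) x y
  ev-project Q x y = trans
    (linear-project Q (ev-isLinear x y))
    (Π₆-cong (refl {x = ev Q x y}) (ev-γ′ Q x y) (ev-γ′² Q x y) (ev-ε′ Q x y) (ev-ρ Q x y) (ev-σ Q x y))

  private
    s₂ : ∀ x y → - (- y) - - x ≡ x + y
    s₂ = solve-∀ ring
    s₃ : ∀ x y → - y + - x ≡ - x - y
    s₃ = solve-∀ ring
    s₄ : ∀ x y → - y - (- x - y) ≡ x
    s₄ = solve-∀ ring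
    s₆ : ∀ x y → y + (- x - y) ≡ - x
    s₆ = solve-∀ ring
    s₇ : ∀ x y → - (- x - y) - x ≡ y
    s₇ = solve-∀ ring
    s₈ : ∀ x y → (- x - y) + x ≡ - y
    s₈ = solve-∀ ring
    s₁₀ : ∀ x y → - (- x) - (x + y) ≡ - y
    s₁₀ = solve-∀ ring
    s₁₁ : ∀ x y → - (x + y) - - y ≡ - x
    s₁₁ = solve-∀ ring

  module _ (F : ℚ → ℚ → ℚ) (x y : ℚ) where

    private
      a b c d e f : ℚ
      a = F x y
      b = F y (- x - y)
      c = F (- x - y) x
      d = F (- y) (- x)
      e = F (- x) (x + y)
      f = F (x + y) (- y)

    -- Substituting ε′ after averaging exchanges the triples (a , b , c) and (d , e , f), which
    -- carry the same weights.
    Π-ε′ : Π F x y ≡ Π F (- y) (- x)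
    Π-ε′ = trans (lemma ⅙ a b c d e f) (sym (Π₆-cong (refl {x = d})
      (cong (F (- x)) (s₂ x y)) (cong (λ u → F u (- y)) (s₂ x y))
      (cong₂ F (-‿involutive x) (-‿involutive y))
      (cong₂ F (-‿involutive y) (s₃ x y)) (cong₂ F (s₃ x y) (-‿involutive x))))
      where
      lemma : ∀ k a b c d e f →
        k * ((((1ℚ + 1ℚ) * a + - 1ℚ * b) + - 1ℚ * c) + (((1ℚ + 1ℚ) * d + - 1ℚ * e) + - 1ℚ * f))
        ≡ k * ((((1ℚ + 1ℚ) * d + - 1ℚ * e) + - 1ℚ * f) + (((1ℚ + 1ℚ) * a + - 1ℚ * b) + - 1ℚ * c))
      lemma = solve-∀ ring

    -- The substitutions rotate (a , b , c) forwards and (d , e , f) backwards, so each of the six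
    -- values collects the weights 2, - 1 and - 1. Together with the preceding identity this places
    -- the image of the projection in W.
    Π-γ′ : (Π F x y + Π F y (- x - y)) + Π F (- x - y) x ≡ 0ℚ
    Π-γ′ = trans (cong₂ _+_ (cong (Π F x y +_)
        (Π₆-cong (refl {x = b}) (cong (F (- x - y)) (s₄ x y)) (cong (λ u → F u y) (s₄ x y))
          (cong (λ u → F u (- y)) (neg-sum x y)) (cong (F (- y)) (s₆ x y)) (cong₂ F (s₆ x y) (neg-sum x y))))
        (Π₆-cong (refl {x = c}) (cong (F x) (s₇ x y)) (cong (λ u → F u (- x - y)) (s₇ x y))
          (cong (F (- x)) (neg-sum x y)) (cong₂ F (neg-sum x y) (s₈ x y)) (cong (λ u → F u (- x)) (s₈ x y))))
      (lemma ⅙ a b c d e f)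
      where
      lemma : ∀ k a b c d e f →
        (k * ((((1ℚ + 1ℚ) * a + - 1ℚ * b) + - 1ℚ * c) + (((1ℚ + 1ℚ) * d + - 1ℚ * e) + - 1ℚ * f))
        + k * ((((1ℚ + 1ℚ) * b + - 1ℚ * c) + - 1ℚ * a) + (((1ℚ + 1ℚ) * f + - 1ℚ * d) + - 1ℚ * e)))
        + k * ((((1ℚ + 1ℚ) * c + - 1ℚ * a) + - 1ℚ * b) + (((1ℚ + 1ℚ) * e + - 1ℚ * f) + - 1ℚ * d)) ≡ 0ℚ
      lemma = solve-∀ ring

    -- Multiplication on the other side: here ε′ acts on the argument before the projection. This
    -- makes the composite of a functional with the projection blind to ε′.
    Π∘ε′ : Π (λ p q → F (- q) (- p)) x y ≡ Π F x y
    Π∘ε′ = trans (Π₆-cong (refl {x = d})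
      (cong (λ u → F u (- y)) (neg-sum x y)) (cong (F (- x)) (neg-sum x y))
      (cong₂ F (-‿involutive x) (-‿involutive y))
      (cong₂ F (sum-neg x y) (-‿involutive x)) (cong₂ F (-‿involutive y) (sum-neg x y)))
      (lemma ⅙ a b c d e f)
      where
      lemma : ∀ k a b c d e f →
        k * ((((1ℚ + 1ℚ) * d + - 1ℚ * f) + - 1ℚ * e) + (((1ℚ + 1ℚ) * a + - 1ℚ * c) + - 1ℚ * b))
        ≡ k * ((((1ℚ + 1ℚ) * a + - 1ℚ * b) + - 1ℚ * c) + (((1ℚ + 1ℚ) * d + - 1ℚ * e) + - 1ℚ * f))
      lemma = solve-∀ ring

    -- The projection annihilates Q ∣ (1 + γ′ + γ′²) for every Q, whereas the analogous relation
    -- above concerns the result of the projection. Again the weights of each value add up to 2 - 1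
    -- - 1.
    Π∘γ′ : (Π F x y + Π (λ p q → F (- p - q) p) x y) + Π (λ p q → F q (- p - q)) x y ≡ 0ℚ
    Π∘γ′ = trans (cong₂ _+_ (cong (Π F x y +_)
        (Π₆-cong (refl {x = c}) (cong (λ u → F u y) (s₄ x y)) (cong (λ u → F u (- x - y)) (s₇ x y))
          (cong (λ u → F u (- y)) (s₂ x y)) (cong (λ u → F u (- x)) (s₁₀ x y)) (cong (λ u → F u (x + y)) (s₁₁ x y))))
        (Π₆-cong (refl {x = b}) (cong (F (- x - y)) (s₄ x y)) (cong (F x) (s₇ x y))
          (cong (F (- x)) (s₂ x y)) (cong (F (x + y)) (s₁₀ x y)) (cong (F (- y)) (s₁₁ x y))))
      (lemma ⅙ a b c d e f)
      where
      lemma : ∀ k a b c d e f →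
        (k * ((((1ℚ + 1ℚ) * a + - 1ℚ * b) + - 1ℚ * c) + (((1ℚ + 1ℚ) * d + - 1ℚ * e) + - 1ℚ * f))
        + k * ((((1ℚ + 1ℚ) * c + - 1ℚ * a) + - 1ℚ * b) + (((1ℚ + 1ℚ) * f + - 1ℚ * d) + - 1ℚ * e)))
        + k * ((((1ℚ + 1ℚ) * b + - 1ℚ * c) + - 1ℚ * a) + (((1ℚ + 1ℚ) * e + - 1ℚ * f) + - 1ℚ * d)) ≡ 0ℚ
      lemma = solve-∀ ring

  -- Each half contributes 3ka - k(a + b + c), so one sixth of the total is ka. The scalar k is 1
  -- for elements of W and - 1 for the values arising from the pairing.
  Π₆-fixed : ∀ k a b c → (a + b) + c ≡ 0ℚ → Π₆ (k * a) (k * b) (k * c) (k * a) (k * c) (k * b) ≡ k * a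
  Π₆-fixed k a b c sum≡0 = begin
    Π₆ (k * a) (k * b) (k * c) (k * a) (k * c) (k * b)
      ≡⟨ lemma₁ ⅙ k a b c ⟩
    ⅙ * (1ℚ + 1ℚ + 1ℚ + 1ℚ + 1ℚ + 1ℚ) * (k * a) + - (⅙ * (1ℚ + 1ℚ) * k) * ((a + b) + c)
      -- The product of `⅙` with the sum of six ones evaluates to `1ℚ` by computation.
      ≡⟨ cong (λ s → ⅙ * (1ℚ + 1ℚ + 1ℚ + 1ℚ + 1ℚ + 1ℚ) * (k * a) + - (⅙ * (1ℚ + 1ℚ) * k) * s) sum≡0 ⟩
    1ℚ * (k * a) + - (⅙ * (1ℚ + 1ℚ) * k) * 0ℚ
      ≡⟨ lemma₂ (k * a) (- (⅙ * (1ℚ + 1ℚ) * k)) ⟩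
    k * a ∎
    where
    lemma₁ : ∀ j k a b c →
      j * ((((1ℚ + 1ℚ) * (k * a) + - 1ℚ * (k * b)) + - 1ℚ * (k * c))
         + (((1ℚ + 1ℚ) * (k * a) + - 1ℚ * (k * c)) + - 1ℚ * (k * b)))
      ≡ j * (1ℚ + 1ℚ + 1ℚ + 1ℚ + 1ℚ + 1ℚ) * (k * a) + - (j * (1ℚ + 1ℚ) * k) * ((a + b) + c)
    lemma₁ = solve-∀ ring
    lemma₂ : ∀ p q → 1ℚ * p + q * 0ℚ ≡ p
    lemma₂ = solve-∀ ring

  abstract

    project-InW : ∀ {w} (Q : V w) → InW w (project Q)
    project-InW Q = WAt⇒InW (project Q) (λ x y →
      trans (ev-project Q x y) (trans (Π-ε′ (ev Q) x y) (sym (ev-project Q (- y) (- x)))) ,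
      trans (cong₂ _+_ (cong₂ _+_ (ev-project Q x y) (ev-project Q y (- x - y))) (ev-project Q (- x - y) x))
        (Π-γ′ (ev Q) x y))

  project-fixes-W : ∀ {w} (Q : V w) → InW w Q → project Q ≈ Q
  project-fixes-W {w} Q Q∈W = ev-injective (project Q) Q 0ℚ (λ x _ → trans (ev-project Q x 1ℚ) (fixed x 1ℚ))
    where
    F : ℚ → ℚ → ℚ
    F = ev Q
    symmetric : ∀ x y → F x y ≡ F (- y) (- x)
    symmetric x y = proj₁ (InW⇒WAt Q Q∈W x y)
    fixed : ∀ x y → Π F x y ≡ F x y
    fixed x y = trans (Π₆-cong
        (sym (*-identityˡ (F x y))) (sym (*-identityˡ (F y z))) (sym (*-identityˡ (F z x)))
        (trans (sym (symmetric x y)) (sym (*-identityˡ (F x y))))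
        (trans (sym (trans (symmetric z x) (cong (F (- x)) (neg-sum x y)))) (sym (*-identityˡ (F z x))))
        (trans (sym (trans (symmetric y z) (cong (λ u → F u (- y)) (neg-sum x y)))) (sym (*-identityˡ (F y z)))))
      (trans (Π₆-fixed 1ℚ (F x y) (F y z) (F z x) (proj₂ (InW⇒WAt Q Q∈W x y))) (*-identityˡ (F x y)))
      where
      z : ℚ
      z = - x - y

  -- The hypothesis compares projections and not the forms themselves, so that it also covers
  -- distinct forms with equal projection, such as Q and Q ∣ ε′.
  project-cong : ∀ {w} (P Q : V w) → (∀ x y → Π (ev P) x y ≡ Π (ev Q) x y) → project P ≈ project Q
  project-cong P Q eq = ev-injective (project P) (project Q) 0ℚ (λ x _ →
    trans (ev-project P x 1ℚ) (trans (eq x 1ℚ) (sym (ev-project Q x 1ℚ))))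

  Π-cong : ∀ {F G : ℚ → ℚ → ℚ} → (∀ x y → F x y ≡ G x y) → ∀ x y → Π F x y ≡ Π G x y
  Π-cong eq x y = Π₆-cong (eq x y) (eq y (- x - y)) (eq (- x - y) x) (eq (- y) (- x)) (eq (- x) (x + y)) (eq (x + y) (- y))

  Π-+ : ∀ (F G : ℚ → ℚ → ℚ) x y → Π (λ p q → F p q + G p q) x y ≡ Π F x y + Π G x y
  Π-+ F G x y = lemma ⅙ (F x y) (F y (- x - y)) (F (- x - y) x) (F (- y) (- x)) (F (- x) (x + y)) (F (x + y) (- y))
    (G x y) (G y (- x - y)) (G (- x - y) x) (G (- y) (- x)) (G (- x) (x + y)) (G (x + y) (- y))
    where
    lemma : ∀ k a b c d e f a′ b′ c′ d′ e′ f′ →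
      k * ((((1ℚ + 1ℚ) * (a + a′) + - 1ℚ * (b + b′)) + - 1ℚ * (c + c′))
         + (((1ℚ + 1ℚ) * (d + d′) + - 1ℚ * (e + e′)) + - 1ℚ * (f + f′)))
      ≡ k * ((((1ℚ + 1ℚ) * a + - 1ℚ * b) + - 1ℚ * c) + (((1ℚ + 1ℚ) * d + - 1ℚ * e) + - 1ℚ * f))
      + k * ((((1ℚ + 1ℚ) * a′ + - 1ℚ * b′) + - 1ℚ * c′) + (((1ℚ + 1ℚ) * d′ + - 1ℚ * e′) + - 1ℚ * f′))
    lemma = solve-∀ ring

  Π-* : ∀ m (F : ℚ → ℚ → ℚ) x y → Π (λ p q → m * F p q) x y ≡ m * Π F x y
  Π-* m F x y = lemma ⅙ m (F x y) (F y (- x - y)) (F (- x - y) x) (F (- y) (- x)) (F (- x) (x + y)) (F (x + y) (- y))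
    where
    lemma : ∀ k m a b c d e f →
      k * ((((1ℚ + 1ℚ) * (m * a) + - 1ℚ * (m * b)) + - 1ℚ * (m * c))
         + (((1ℚ + 1ℚ) * (m * d) + - 1ℚ * (m * e)) + - 1ℚ * (m * f)))
      ≡ m * (k * ((((1ℚ + 1ℚ) * a + - 1ℚ * b) + - 1ℚ * c) + (((1ℚ + 1ℚ) * d + - 1ℚ * e) + - 1ℚ * f)))
    lemma = solve-∀ ring

  project-⊕ : ∀ {w} (P Q : V w) → project (P ⊕ Q) ≈ (project P ⊕ project Q)
  project-⊕ P Q = ev-injective (project (P ⊕ Q)) (project P ⊕ project Q) 0ℚ (λ x _ → begin
    ev (project (P ⊕ Q)) x 1ℚ                      ≡⟨ ev-project (P ⊕ Q) x 1ℚ ⟩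
    Π (ev (P ⊕ Q)) x 1ℚ                            ≡⟨ Π-cong (ev-⊕ P Q) x 1ℚ ⟩
    Π (λ p q → ev P p q + ev Q p q) x 1ℚ           ≡⟨ Π-+ (ev P) (ev Q) x 1ℚ ⟩
    Π (ev P) x 1ℚ + Π (ev Q) x 1ℚ                  ≡⟨ sym (cong₂ _+_ (ev-project P x 1ℚ) (ev-project Q x 1ℚ)) ⟩
    ev (project P) x 1ℚ + ev (project Q) x 1ℚ      ≡⟨ sym (ev-⊕ (project P) (project Q) x 1ℚ) ⟩
    ev (project P ⊕ project Q) x 1ℚ                ∎)

  project-⊛ : ∀ {w} c (P : V w) → project (c ⊛ P) ≈ (c ⊛ project P)
  project-⊛ c P = ev-injective (project (c ⊛ P)) (c ⊛ project P) 0ℚ (λ x _ → begin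
    ev (project (c ⊛ P)) x 1ℚ                      ≡⟨ ev-project (c ⊛ P) x 1ℚ ⟩
    Π (ev (c ⊛ P)) x 1ℚ                            ≡⟨ Π-cong (ev-⊛ c P) x 1ℚ ⟩
    Π (λ p q → c * ev P p q) x 1ℚ                  ≡⟨ Π-* c (ev P) x 1ℚ ⟩
    c * Π (ev P) x 1ℚ                              ≡⟨ cong (c *_) (sym (ev-project P x 1ℚ)) ⟩
    c * ev (project P) x 1ℚ                        ≡⟨ sym (ev-⊛ c (project P) x 1ℚ) ⟩
    ev (c ⊛ project P) x 1ℚ                        ∎)

  InW-resp-≈ : ∀ {w} (P Q : V w) → P ≈ Q → InW w P → InW w Q
  InW-resp-≈ P Q P≈Q P∈W = WAt⇒InW Q (λ x y →
    let at = InW⇒WAt P P∈W x y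
    in trans (sym (ev-cong P≈Q x y)) (trans (proj₁ at) (ev-cong P≈Q (- y) (- x))) ,
       trans (sym (cong₂ _+_ (cong₂ _+_ (ev-cong P≈Q x y) (ev-cong P≈Q y (- x - y))) (ev-cong P≈Q (- x - y) x)))
         (proj₂ at))

  linearPower-substitution : ∀ {w} u v u′ v′ (φ χ : ℚ → ℚ → ℚ) →
    (∀ p q → u′ * p + v′ * q ≡ u * φ p q + v * χ p q) →
    ∀ p q → ev (linearPower {w} u′ v′) p q ≡ ev (linearPower {w} u v) (φ p q) (χ p q)
  linearPower-substitution {w} u v u′ v′ φ χ eq p q = trans (ev-linearPower {w} u′ v′ p q)
    (trans (cong (_^ w) (eq p q)) (sym (ev-linearPower {w} u v (φ p q) (χ p q))))

  -- On U the pairing does not see the projection, which is adjoint to the one onto U.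
  pairing-project-linearPower : ∀ {w} (R : V w) → (∀ x y → UAt (ev R) x y) → ∀ u v →
    ⟨ R , project (linearPower u v) ⟩ ≡ - 1ℚ * ev R (- v) u
  pairing-project-linearPower {w} R at u v = begin
    ⟨ R , project L ⟩
      ≡⟨ linear-project L (pairing-isLinear R) ⟩
    Π₆ ⟨ R , L ⟩ ⟨ R , L ∣ γ′ ⟩ ⟨ R , L ∣ (γ′ · γ′) ⟩ ⟨ R , L ∣ ε′ ⟩ ⟨ R , L ∣ ρ ⟩ ⟨ R , L ∣ σ ⟩
      -- Each group element turns the power into another power (u′X + v′Y)ʷ, read by R at (- v′ ,
      -- u′). With X = - v, Y = u and Z = - X - Y these six points are the ordered pairs of distinct
      -- members of X, Y, Z.
      ≡⟨ Π₆-cong (pairing-linearPower R u v)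
           (at-point (L ∣ γ′) (λ x y → y) (λ x y → - x - y) (ev-γ′ L) (- v) (u - v) (e₁ u v) (- (u - v)) (- v) refl refl)
           (at-point (L ∣ (γ′ · γ′)) (λ x y → - x - y) (λ x y → x) (ev-γ′² L) (v - u) (- u) (e₂ u v) u (v - u) (-‿involutive u) refl)
           (at-point (L ∣ ε′) (λ x y → - y) (λ x y → - x) (ev-ε′ L) (- v) (- u) (e₃ u v) u (- v) (-‿involutive u) refl)
           (at-point (L ∣ ρ) (λ x y → - x) (λ x y → x + y) (ev-ρ L) (v - u) v (e₄ u v) (- v) (v - u) refl refl)
           (at-point (L ∣ σ) (λ x y → x + y) (λ x y → - y) (ev-σ L) u (u - v) (e₅ u v) (- (u - v)) u refl refl) ⟩
    Π₆ (- 1ℚ * F X Y) (- 1ℚ * F (- (u - v)) X) (- 1ℚ * F Y (v - u)) (- 1ℚ * F Y X) (- 1ℚ * F X (v - u)) (- 1ℚ * F (- (u - v)) Y)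
      -- The symmetry of R reduces the six pairs to the three cyclically ordered ones.
      ≡⟨ Π₆-cong (refl {x = - 1ℚ * F X Y})
           (cong (- 1ℚ *_) (cong (λ t → F t X) (z₁ u v)))
           (cong (- 1ℚ *_) (cong (F Y) (z₂ u v)))
           (cong (- 1ℚ *_) (proj₁ (at Y X)))
           (cong (- 1ℚ *_) (trans (cong (F X) (z₂ u v)) (proj₁ (at X Z))) )
           (cong (- 1ℚ *_) (trans (cong (λ t → F t Y) (z₁ u v)) (proj₁ (at Z Y)))) ⟩
    Π₆ (- 1ℚ * F X Y) (- 1ℚ * F Z X) (- 1ℚ * F Y Z) (- 1ℚ * F X Y) (- 1ℚ * F Z X) (- 1ℚ * F Y Z)
      -- The values for γ′ and γ′² arrive interchanged, since the adjoint of γ′ is its inverse; they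
      -- have equal weights in `Π₆`.
      ≡⟨ reorder ⅙ (- 1ℚ * F X Y) (- 1ℚ * F Z X) (- 1ℚ * F Y Z) ⟩
    Π₆ (- 1ℚ * F X Y) (- 1ℚ * F Y Z) (- 1ℚ * F Z X) (- 1ℚ * F X Y) (- 1ℚ * F Z X) (- 1ℚ * F Y Z)
      ≡⟨ Π₆-fixed (- 1ℚ) (F X Y) (F Y Z) (F Z X) (proj₂ (at X Y)) ⟩
    - 1ℚ * F X Y ∎
    where
    L : V w
    L = linearPower u v
    F : ℚ → ℚ → ℚ
    F = ev R
    X Y Z : ℚ
    X = - v
    Y = u
    Z = - X - Y
    at-point : ∀ (M : V w) (φ χ : ℚ → ℚ → ℚ) → (∀ x y → ev M x y ≡ ev L (φ x y) (χ x y)) →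
      ∀ u′ v′ → (∀ p q → u′ * p + v′ * q ≡ u * φ p q + v * χ p q) →
      ∀ s t → - v′ ≡ s → u′ ≡ t → ⟨ R , M ⟩ ≡ - 1ℚ * F s t
    at-point M φ χ ev-M u′ v′ eq s t -v′≡s u′≡t = trans
      (proj₁ (pairing-isLinear R) M (linearPower u′ v′) (ev-injective M (linearPower u′ v′) 0ℚ (λ x _ →
        trans (ev-M x 1ℚ) (sym (linearPower-substitution {w} u v u′ v′ φ χ eq x 1ℚ)))))
      (trans (pairing-linearPower R u′ v′) (cong (- 1ℚ *_) (cong₂ F -v′≡s u′≡t)))
    e₁ : ∀ u v p q → - v * p + (u - v) * q ≡ u * q + v * (- p - q)
    e₁ = solve-∀ ring
    e₂ : ∀ u v p q → (v - u) * p + - u * q ≡ u * (- p - q) + v * p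
    e₂ = solve-∀ ring
    e₃ : ∀ u v p q → - v * p + - u * q ≡ u * - q + v * - p
    e₃ = solve-∀ ring
    e₄ : ∀ u v p q → (v - u) * p + v * q ≡ u * - p + v * (p + q)
    e₄ = solve-∀ ring
    e₅ : ∀ u v p q → u * p + (u - v) * q ≡ u * (p + q) + v * - q
    e₅ = solve-∀ ring
    z₁ : ∀ u v → - (u - v) ≡ - (- v) - u
    z₁ = solve-∀ ring
    z₂ : ∀ u v → v - u ≡ - (- v) - u
    z₂ = solve-∀ ring
    reorder : ∀ k a b c →
      k * ((((1ℚ + 1ℚ) * a + - 1ℚ * b) + - 1ℚ * c) + (((1ℚ + 1ℚ) * a + - 1ℚ * b) + - 1ℚ * c))
      ≡ k * ((((1ℚ + 1ℚ) * a + - 1ℚ * c) + - 1ℚ * b) + (((1ℚ + 1ℚ) * a + - 1ℚ * b) + - 1ℚ * c))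
    reorder = solve-∀ ring

  -- The isomorphism from LSh to the dual of W

  pair-injective : ∀ {w} (P P′ : V w) → InLSh w P → InLSh w P′ →
    (∀ Q → InW w Q → pair P Q ≡ pair P′ Q) → P ≈ P′
  pair-injective {w} P P′ P∈LSh P′∈LSh agree = ∣δ-injective P P′
    (ev-injective (P ∣ δ) (P′ ∣ δ) 0ℚ (λ x _ → begin
      ev (P ∣ δ) x 1ℚ           ≡⟨ cong (λ t → ev (P ∣ δ) t 1ℚ) (sym (-‿involutive x)) ⟩
      -- The test element is the projection of (X - xY)ʷ, which lies in W and whose pairing reads
      -- off the value at (x , 1) up to sign.
      ev (P ∣ δ) (- (- x)) 1ℚ   ≡⟨ *-cancel-≢0 { - 1ℚ} {ev (P ∣ δ) (- (- x)) 1ℚ} {ev (P′ ∣ δ) (- (- x)) 1ℚ} (λ ()) (trans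
                                     (sym (pairing-project-linearPower (P ∣ δ) (InLSh⇒UAt P P∈LSh) 1ℚ (- x)))
                                     (trans (agree (project (linearPower 1ℚ (- x))) (project-InW (linearPower 1ℚ (- x))))
                                       (pairing-project-linearPower (P′ ∣ δ) (InLSh⇒UAt P′ P′∈LSh) 1ℚ (- x)))) ⟩
      ev (P′ ∣ δ) (- (- x)) 1ℚ  ≡⟨ cong (λ t → ev (P′ ∣ δ) t 1ℚ) (-‿involutive x) ⟩
      ev (P′ ∣ δ) x 1ℚ          ∎))

  module _ {w} (φ : (Q : V w) → InW w Q → ℚ) (φ-linear : IsLinearW w φ) where

    private
      ψ : V w → ℚ
      ψ Q = φ (project Q) (project-InW Q)

      ψ-cong : ∀ P Q → project P ≈ project Q → ψ P ≡ ψ Q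
      ψ-cong P Q = proj₁ φ-linear (project P) (project Q) (project-InW P) (project-InW Q)

      ψ-isLinear : IsLinear ψ
      ψ-isLinear =
        (λ P Q P≈Q → ψ-cong P Q (project-cong P Q (Π-cong (ev-cong P≈Q)))) ,
        (λ P Q → let p = InW-resp-≈ (project (P ⊕ Q)) (project P ⊕ project Q) (project-⊕ P Q) (project-InW (P ⊕ Q)) in
          trans (proj₁ φ-linear (project (P ⊕ Q)) (project P ⊕ project Q) (project-InW (P ⊕ Q)) p (project-⊕ P Q))
            (proj₁ (proj₂ φ-linear) (project P) (project Q) (project-InW P) (project-InW Q) p)) ,
        (λ c P → let p = InW-resp-≈ (project (c ⊛ P)) (c ⊛ project P) (project-⊛ c P) (project-InW (c ⊛ P)) in
          trans (proj₁ φ-linear (project (c ⊛ P)) (c ⊛ project P) (project-InW (c ⊛ P)) p (project-⊛ c P))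
            (proj₂ (proj₂ φ-linear) c (project P) (project-InW P) p))

      R : V w
      R = representative ψ

      -- The coefficients are chosen so that the pairing of R with `L x y` is minus the value of R
      -- at (x , y).
      L : ℚ → ℚ → V w
      L x y = linearPower y (- x)

      ev-R : ∀ x y → ev R x y ≡ - 1ℚ * ψ (L x y)
      ev-R x y = begin
        ev R x y                          ≡⟨ cong (λ t → ev R t y) (sym (-‿involutive x)) ⟩
        ev R (- (- x)) y                  ≡⟨ lemma (ev R (- (- x)) y) ⟩
        - 1ℚ * (- 1ℚ * ev R (- (- x)) y)  ≡⟨ cong (- 1ℚ *_) (sym (pairing-linearPower R y (- x))) ⟩
        - 1ℚ * ⟨ R , L x y ⟩              ≡⟨ cong (- 1ℚ *_) (pairing-representative ψ-isLinear (L x y)) ⟩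
        - 1ℚ * ψ (L x y)                  ∎
        where
        lemma : ∀ p → p ≡ - 1ℚ * (- 1ℚ * p)
        lemma = solve-∀ ring

      -- Acting by ε′ carries `L x y` to `L y x`, and the projection absorbs ε′.
      symmetric : ∀ x y → ψ (L x y) ≡ ψ (L y x)
      symmetric x y = ψ-cong (L x y) (L y x) (project-cong (L x y) (L y x) (λ p q → sym (trans
        (Π-cong (linearPower-substitution {w} y (- x) x (- y) (λ p q → - q) (λ p q → - p) (lemma x y)) p q)
        (Π∘ε′ (ev (L x y)) p q))))
        where
        lemma : ∀ x y p q → x * p + - y * q ≡ y * - q + - x * - p
        lemma = solve-∀ ring

      -- With z = - x - y, acting by γ′² and γ′ carries `L x y` to `L y z` and `L z x`. The sum of
      -- the three powers is thus the image of one of them under 1 + γ′ + γ′², which the projection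
      -- annihilates.
      cyclic : ∀ x y → (ψ (L x y) + ψ (L y (- x - y))) + ψ (L (- x - y) x) ≡ 0ℚ
      cyclic x y = begin
        (ψ L₁ + ψ L₂) + ψ L₃       ≡⟨ cong (_+ ψ L₃) (sym (proj₁ (proj₂ ψ-isLinear) L₁ L₂)) ⟩
        ψ (L₁ ⊕ L₂) + ψ L₃         ≡⟨ sym (proj₁ (proj₂ ψ-isLinear) (L₁ ⊕ L₂) L₃) ⟩
        ψ ((L₁ ⊕ L₂) ⊕ L₃)         ≡⟨ ψ-cong ((L₁ ⊕ L₂) ⊕ L₃) zeroV (project-cong ((L₁ ⊕ L₂) ⊕ L₃) zeroV (λ p q →
                                        trans (sum≡0 p q) (sym (zero≡0 p q)))) ⟩
        ψ zeroV                    ≡⟨ linear-zeroV ψ-isLinear ⟩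
        0ℚ                         ∎
        where
        z : ℚ
        z = - x - y
        L₁ L₂ L₃ : V w
        L₁ = L x y
        L₂ = L y z
        L₃ = L z x
        zero≡0 : ∀ p q → Π (ev (zeroV {w})) p q ≡ 0ℚ
        -- On the zero function `Π` evaluates to `0ℚ` by computation, so congruence alone suffices.
        zero≡0 p q = Π-cong (ev-zeroV {w}) p q
        lemma₂ : ∀ x y p q → (- x - y) * p + - y * q ≡ y * (- p - q) + - x * p
        lemma₂ = solve-∀ ring
        lemma₃ : ∀ x y p q → x * p + - (- x - y) * q ≡ y * q + - x * (- p - q)
        lemma₃ = solve-∀ ring
        sum≡0 : ∀ p q → Π (ev ((L₁ ⊕ L₂) ⊕ L₃)) p q ≡ 0ℚ
        sum≡0 p q = begin
          Π (ev ((L₁ ⊕ L₂) ⊕ L₃)) p q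
            ≡⟨ Π-cong (λ s t → trans (ev-⊕ (L₁ ⊕ L₂) L₃ s t) (cong (_+ ev L₃ s t) (ev-⊕ L₁ L₂ s t))) p q ⟩
          Π (λ s t → (ev L₁ s t + ev L₂ s t) + ev L₃ s t) p q
            ≡⟨ trans (Π-+ (λ s t → ev L₁ s t + ev L₂ s t) (ev L₃) p q)
                 (cong (_+ Π (ev L₃) p q) (Π-+ (ev L₁) (ev L₂) p q)) ⟩
          (Π (ev L₁) p q + Π (ev L₂) p q) + Π (ev L₃) p q
            ≡⟨ cong₂ _+_ (cong (Π (ev L₁) p q +_)
                 (Π-cong (linearPower-substitution {w} y (- x) z (- y) (λ p q → - p - q) (λ p q → p) (lemma₂ x y)) p q))
                 (Π-cong (linearPower-substitution {w} y (- x) x (- z) (λ p q → q) (λ p q → - p - q) (lemma₃ x y)) p q) ⟩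
          (Π (ev L₁) p q + Π (λ p q → ev L₁ (- p - q) p) p q) + Π (λ p q → ev L₁ q (- p - q)) p q
            ≡⟨ Π∘γ′ (ev L₁) p q ⟩
          0ℚ ∎

      R∈U : ∀ x y → UAt (ev R) x y
      R∈U x y =
        trans (ev-R x y) (trans (cong (- 1ℚ *_) (symmetric x y)) (sym (ev-R y x))) ,
        (begin
          (ev R x y + ev R y (- x - y)) + ev R (- x - y) x
            ≡⟨ cong₂ _+_ (cong₂ _+_ (ev-R x y) (ev-R y (- x - y))) (ev-R (- x - y) x) ⟩
          (- 1ℚ * ψ (L x y) + - 1ℚ * ψ (L y (- x - y))) + - 1ℚ * ψ (L (- x - y) x)
            ≡⟨ lemma (ψ (L x y)) (ψ (L y (- x - y))) (ψ (L (- x - y) x)) ⟩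
          - 1ℚ * ((ψ (L x y) + ψ (L y (- x - y))) + ψ (L (- x - y) x))
            ≡⟨ cong (- 1ℚ *_) (cyclic x y) ⟩
          - 1ℚ * 0ℚ
            ≡⟨ *-zeroʳ (- 1ℚ) ⟩
          0ℚ ∎)
        where
        lemma : ∀ p q r → (- 1ℚ * p + - 1ℚ * q) + - 1ℚ * r ≡ - 1ℚ * ((p + q) + r)
        lemma = solve-∀ ring

    pair-surjective : Σ (V w) λ P → InLSh w P × ((Q : V w) (q : InW w Q) → pair P Q ≡ φ Q q)
    -- `pair` applies δ to its first argument before pairing, and δ is an involution; hence the
    -- preimage is R ∣ δ.
    pair-surjective = R ∣ δ , UAt⇒InLSh R R∈U , λ Q q → begin
      ⟨ (R ∣ δ) ∣ δ , Q ⟩   ≡⟨ pairing-congˡ ((R ∣ δ) ∣ δ) R Q (∣δ-involutive R) ⟩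
      ⟨ R , Q ⟩             ≡⟨ pairing-representative ψ-isLinear Q ⟩
      ψ Q                   ≡⟨ proj₁ φ-linear (project Q) Q (project-InW Q) q (project-fixes-W Q q) ⟩
      φ Q q                 ∎

open Shuffle
open import Data.Nat using (ℕ; _+_; _/_; _%_)
open import Data.Rational using (ℚ) renaming (_+_ to _+ℚ_; _*_ to _*ℚ_)
open import Data.Product using (Σ; _×_; proj₁; _,_)
open import Relation.Binary.PropositionalEquality using (_≡_)

theorem5p3 : (w : ℕ) →
    (w % 2 ≡ 0 →
        ((P : V w) → InLSh w P → InW w (P ∣ δ))
      × ((P P′ : V w) → InLSh w P → InLSh w P′ → (P ∣ δ) ≈ (P′ ∣ δ) → P ≈ P′)
      × ((Q : V w) → InW w Q → Σ (V w) λ P → InLSh w P × (P ∣ δ) ≈ Q))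
  × (w % 2 ≡ 1 →
        ((P P′ Q : V w) → pair (P ⊕ P′) Q ≡ pair P Q +ℚ pair P′ Q)
      × ((c : ℚ) (P Q : V w) → pair (c ⊛ P) Q ≡ c *ℚ pair P Q)
      × ((P P′ : V w) → InLSh w P → InLSh w P′ →
           ((Q : V w) → InW w Q → pair P Q ≡ pair P′ Q) → P ≈ P′)
      × ((f : FunctionalW w) → Σ (V w) λ P → InLSh w P
           × ((Q : V w) (q : InW w Q) → pair P Q ≡ proj₁ f Q q)))
  × HasDim (InLSh w) ((w + 2) / 3)
theorem5p3 w =
  (λ even →
    LSh∣δ⊆W even ,
    (λ P P′ _ _ → ∣δ-injective P P′) ,
    (λ Q Q∈W → Q ∣ δ , W∣δ⊆LSh even Q Q∈W , ∣δ-involutive Q)) ,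
  (λ _ → pair-⊕ , pair-⊛ , pair-injective , λ (φ , φ-linear) → pair-surjective φ φ-linear) ,
  hasDim-LSh w
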